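{- Suppose $n>k\geq\ell\geq t\geq 1$ and $q\geq 2$ are integers. The following hold. (i) Suppose $n\geq t+2e(k-t)k/q$. If $\mathcal{F}\subseteq\mathcal{S}_{n,k,q}$ is $t$-intersecting, then $|\mathcal{F}|\leq\binom{n-t}{k-t}q^{k-t}$, with equality if and only if $\mathcal{F}=\{(A,f)\in\mathcal{S}_{n,k,q}:X\subseteq A,\ f|_X=f_0\}$ for some $X\in\binom{[n]}{t}$ and $f_0:X\to[q]$. (ii) Suppose $n\geq t+2e\cdot\max\{(t+2)^2(k-t),\,k^2\}/q$. If $\mathcal{F}\subseteq\mathcal{S}_{n,k,q}$ and $\mathcal{G}\subseteq\mathcal{S}_{n,\ell,q}$ are cross $t$-intersecting, then $|\mathcal{F}||\mathcal{G}|\leq\binom{n-t}{k-t}\binom{n-t}{\ell-t}q^{k+\ell-2t}$, with equality if and only if $\mathcal{F}=\{(A,f)\in\mathcal{S}_{n,k,q}:X\subseteq A,\ f|_X=f_0\}$ and $\mathcal{G}=\{(B,g)\in\mathcal{S}_{n,\ell,q}:X\subseteq B,\ g|_X=f_0\}$ for some $X\in\binom{[n]}{t}$ and $f_0:X\to[q]$.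
   Context: $[n]=\{1,\dots,n\}$, $\binom{[n]}{k}$ is the family of all $k$-subsets of $[n]$, and $e$ is the base of the natural logarithm. A $q$-signed $k$-set on $[n]$ is a pair $(A,f)$ with $A\in\binom{[n]}{k}$ and $f:A\to[q]$ a function; $\mathcal{S}_{n,k,q}$ is the set of all such pairs. A family $\mathcal{F}\subseteq\mathcal{S}_{n,k,q}$ is $t$-intersecting if for all $(A,f),(B,g)\in\mathcal{F}$ there are at least $t$ elements of $A\cap B$ on which $f$ and $g$ agree. Families $\mathcal{F}\subseteq\mathcal{S}_{n,k,q}$ and $\mathcal{G}\subseteq\mathcal{S}_{n,\ell,q}$ are cross $t$-intersecting if for all $(A,f)\in\mathcal{F}$ and $(B,g)\in\mathcal{G}$ there are at least $t$ elements of $A\cap B$ on which $f$ and $g$ agree. -}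

module Defs where

open import Data.Fin.Base using (Fin)
open import Data.Fin.Subset using (Subset; Side; inside; outside; ∣_∣; _∈_; _⊆_; _∩_)
open import Data.Integer.Base using (+_)
open import Data.List.Base using (List; length)
import Data.List.Membership.Propositional as List
open import Data.List.Relation.Unary.Unique.Propositional using (Unique)
open import Data.Nat.Base as ℕ using (ℕ; zero; suc; NonZero; _!)
open import Data.Nat.Properties using (_!≢0)
open import Data.Product.Base using (Σ; _×_)
open import Data.Rational.Base as ℚ using (ℚ; 1ℚ; _/_)
open import Data.Unit.Base using (⊤)
open import Data.Vec.Base using (here; there)
open import Data.Vec.Relation.Unary.All using (All; _∷_)
open import Function.Bundles using (_⇔_)
open import Relation.Binary.PropositionalEquality.Core using (_≡_)

private
  variable
    n k ℓ q : ℕ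

-- The ground set [n] is Fin n and the set of signs [q] is Fin q.

Label : ℕ → Side → Set
Label q inside  = Fin q
Label q outside = ⊤

-- Functions A → [q], as tables holding a sign at each position in A and the
-- trivial value elsewhere.  Propositional equality of tables is thus
-- pointwise equality of functions, without function extensionality.
Signing : ℕ → Subset n → Set
Signing q A = All (Label q) A

infixl 9 _⟨_⟩

_⟨_⟩ : {A : Subset n} {x : Fin n} → Signing q A → x ∈ A → Fin q
(a ∷ _) ⟨ here ⟩    = a
(_ ∷ f) ⟨ there p ⟩ = f ⟨ p ⟩

record SignedSet (n k q : ℕ) : Set where
  constructor signedSet
  field
    support : Subset n
    size    : ∣ support ∣ ≡ k
    sign    : Signing q support

open SignedSet public

-- A subset of SignedSet n k q, listed without repetition in arbitrary order.
record Family (n k q : ℕ) : Set where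
  constructor family
  field
    members : List (SignedSet n k q)
    unique  : Unique members

open Family public

infix 4 _∈ᶠ_

_∈ᶠ_ : SignedSet n k q → Family n k q → Set
S ∈ᶠ F = S List.∈ members F

card : Family n k q → ℕ
card F = length (members F)

AgreeAt : {A B : Subset n} → Signing q A → Signing q B → Fin n → Set
AgreeAt {A = A} {B = B} f g x =
  Σ (x ∈ A) λ p → Σ (x ∈ B) λ r → f ⟨ p ⟩ ≡ g ⟨ r ⟩

AgreeOnAtLeast : ℕ → SignedSet n k q → SignedSet n ℓ q → Set
AgreeOnAtLeast {n = n} t S T =
  Σ (Subset n) λ C → C ⊆ support S ∩ support T
                   × t ℕ.≤ ∣ C ∣
                   × (∀ x → x ∈ C → AgreeAt (sign S) (sign T) x)

CrossIntersecting : ℕ → Family n k q → Family n ℓ q → Set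
CrossIntersecting t F G = ∀ S T → S ∈ᶠ F → T ∈ᶠ G → AgreeOnAtLeast t S T

Intersecting : ℕ → Family n k q → Set
Intersecting t F = ∀ S T → S ∈ᶠ F → T ∈ᶠ F → AgreeOnAtLeast t S T

-- X ⊆ A and f|_X = f₀, where S = (A , f).
Extends : (X : Subset n) → Signing q X → SignedSet n k q → Set
Extends X f₀ S =
  Σ (X ⊆ support S) λ X⊆A → ∀ x (p : x ∈ X) → sign S ⟨ X⊆A p ⟩ ≡ f₀ ⟨ p ⟩

-- F = {(A , f) : X ⊆ A, f|_X = f₀}.
IsStar : (X : Subset n) → Signing q X → Family n k q → Set
IsStar X f₀ F = ∀ S → S ∈ᶠ F ⇔ Extends X f₀ S

-- eSum N = 1/0! + 1/1! + ⋯ + 1/N!, so that e = sup_N eSum N.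
eSum : ℕ → ℚ
eSum zero    = 1ℚ
eSum (suc N) = eSum N ℚ.+ ((+ 1) / (suc N) !) {{(suc N) !≢0}}

-- n ≥ t + 2eM/q.  The right-hand side is the supremum over N of
-- t + (2M/q) · eSum N, because 2M/q ≥ 0, so the real inequality holds exactly
-- when n bounds every one of these rationals.
infix 4 _≥_+2e_/_

_≥_+2e_/_ : (n t M q : ℕ) .{{_ : NonZero q}} → Set
n ≥ t +2e M / q =
  ∀ N → ((+ t) / 1) ℚ.+ ((+ (2 ℕ.* M)) / q) ℚ.* eSum N ℚ.≤ ((+ n) / 1)

{-# OPTIONS --safe #-}

-- Suppose every member of F, respectively G, contains a set from a list A, respectively B, of
-- signed sets of size at most t + j, where each set in A agrees with each set in B in at least
-- t places.  Start from the t-subsets of one set in B, and as long as some X agrees with some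
-- T in B in fewer than t places, replace X by its extensions by j + 1 points of T: a set that
-- agrees with T in t places misses at most j points of T, so nothing is lost.  Sets at which
-- this stops before size t + j form a new list A′; the at most C(t+j,t) (j+1)^j sets that reach
-- size t + j lie below few members of F.  Doing the same to B against A′ and descending on j,
-- the process ends when a new list is empty, or when all new sets contain a common t-set Y
-- which some old set avoids, so that F or G is small as well.  The error terms decay
-- geometrically because the number of k-sets above an s-set drops by a factor of at least
-- 2ek from s to s + 1, and e ≥ 8/3 suffices to make their total less than a star.
module Submission where

open import Defs
open import Data.Empty using (⊥; ⊥-elim)
open import Data.Fin.Base using (Fin; zero; suc)
open import Data.Fin.Properties using (_≟_)
open import Data.Fin.Subset using (Subset; inside; outside; ∣_∣; _∈_)
import Data.Integer.Base as ℤ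
import Data.Integer.Properties as ℤP
open import Data.List.Base using (List; []; _∷_; _++_; map; length; concatMap; allFin; cartesianProductWith)
open import Data.List.Membership.Propositional using (find; lose) renaming (_∈_ to _∈ˡ_)
open import Data.List.Membership.Propositional.Properties
open import Data.List.Properties using (length-map; length-++; length-tabulate)
open import Data.List.Relation.Unary.All using (All; []; _∷_; all?)
import Data.List.Relation.Unary.All as All
import Data.List.Relation.Unary.All.Properties as All
open import Data.List.Relation.Unary.Any using (Any; here; there; any?)
import Data.List.Relation.Unary.Any as Any
import Data.List.Relation.Unary.Any.Properties as Any
open import Data.List.Relation.Unary.Unique.Propositional using (Unique; []; _∷_)
import Data.List.Relation.Unary.Unique.Propositional.Properties as Unique
open import Data.Maybe.Base using (Maybe; just; nothing)
open import Data.Maybe.Properties using (≡-dec)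
open import Data.Nat.Base hiding (_/_)
open import Data.Nat.Combinatorics using (_C_; nCk+nC[k+1]≡[n+1]C[k+1]; nC1≡n; nCk≡nC[n∸k]; k>n⇒nCk≡0; nCn≡1)
open import Data.Nat.ListAction using (sum)
open import Data.Nat.Properties hiding (_≟_)
open import Data.Nat.Tactic.RingSolver using (solve-∀)
open import Data.Product.Base using (Σ; ∃₂; _×_; _,_; proj₁; proj₂)
open import Data.Rational.Base as ℚ using (_/_; toℚᵘ)
import Data.Rational.Properties as ℚP
open import Data.Rational.Unnormalised.Base as ℚᵘ using (mkℚᵘ; *≡*)
import Data.Rational.Unnormalised.Properties as ℚᵘP
open import Data.Sum.Base as Sum using (_⊎_; inj₁; inj₂; [_,_]′; map₁; map₂)
open import Data.Unit.Base using (tt)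
open import Data.Vec.Base as Vec using (Vec; []; _∷_; here; there)
import Data.Vec.Properties as Vec
open import Data.Vec.Relation.Unary.All using ([]; _∷_)
open import Function.Base using (_∘_; id)
open import Function.Bundles using (_⇔_; mk⇔; module Equivalence)
open import Relation.Binary.PropositionalEquality
open import Relation.Nullary using (¬_; Dec; yes; no; contradiction)
open import Relation.Nullary.Decidable using (_×-dec_)

-- Both parts rest on a dichotomy: either one `t`-set lies below every member of both families, or
-- the bound is strict. Equality is thus confined to the first case, where it forces full stars.
-- Part (i) is the case of two equal families. The obstacle in (ii) is the ending with an empty new
-- list: one family is then small, but the other is only known to lie in c stars, where c is a
-- binomial C(t+a,t) and may be large. So c and the small side must be bounded together, which costs
-- one more factor C(t+a,t) at every level a. With b = a + 1, the ratio of consecutive error terms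
-- then contains (t+b)²(k-t)/b divided by q(n-t). The two entries of the maximum in (ii) control
-- this quantity for small b and at b = k - t respectively. In (i) the same family stands on both
-- sides, so the bound on the small side alone decides and one binomial suffices.

private
  variable
    n k ℓ q : ℕ

-- Binomial coefficients and geometric decay

nC0≡1 : ∀ n → n C 0 ≡ 1
nC0≡1 n = trans (nCk≡nC[n∸k] {0} {n} z≤n) (nCn≡1 n)

C-absorption : ∀ n k → suc k * (suc n C suc k) ≡ suc n * (n C k)
C-absorption zero zero = refl
C-absorption zero (suc k) = begin
  suc (suc k) * (1 C suc (suc k)) ≡⟨ cong (suc (suc k) *_) (k>n⇒nCk≡0 {1} {suc (suc k)} (s≤s (s≤s z≤n))) ⟩
  suc (suc k) * 0                 ≡⟨ *-zeroʳ (suc (suc k)) ⟩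
  0                               ≡⟨ cong (1 *_) (k>n⇒nCk≡0 {0} {suc k} (s≤s z≤n)) ⟨
  1 * (0 C suc k)                 ∎
  where open ≡-Reasoning
C-absorption (suc n) zero = begin
  1 * (suc (suc n) C 1)       ≡⟨ *-identityˡ _ ⟩
  suc (suc n) C 1             ≡⟨ nC1≡n (suc (suc n)) ⟩
  suc (suc n)                 ≡⟨ *-identityʳ _ ⟨
  suc (suc n) * 1             ≡⟨ cong (suc (suc n) *_) (nC0≡1 (suc n)) ⟨
  suc (suc n) * (suc n C 0)   ∎
  where open ≡-Reasoning
C-absorption (suc n) (suc k) = begin
  suc (suc k) * (suc (suc n) C suc (suc k))
    ≡⟨ cong (suc (suc k) *_) (nCk+nC[k+1]≡[n+1]C[k+1] (suc n) (suc k)) ⟨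
  suc (suc k) * ((suc n C suc k) + (suc n C suc (suc k)))
    ≡⟨ split (suc k) (suc n C suc k) (suc n C suc (suc k)) ⟩
  (suc n C suc k) + (suc k * (suc n C suc k) + suc (suc k) * (suc n C suc (suc k)))
    ≡⟨ cong ((suc n C suc k) +_) (cong₂ _+_ (C-absorption n k) (C-absorption n (suc k))) ⟩
  (suc n C suc k) + (suc n * (n C k) + suc n * (n C suc k))
    ≡⟨ cong ((suc n C suc k) +_) (*-distribˡ-+ (suc n) (n C k) (n C suc k)) ⟨
  (suc n C suc k) + suc n * ((n C k) + (n C suc k))
    ≡⟨ cong (λ z → (suc n C suc k) + suc n * z) (nCk+nC[k+1]≡[n+1]C[k+1] n k) ⟩
  suc (suc n) * (suc n C suc k) ∎
  where
  open ≡-Reasoning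
  split : ∀ k x y → suc k * (x + y) ≡ x + (k * x + suc k * y)
  split = solve-∀

-- Absorption with the lower index complemented. It gives the exact growth factor (t+a+1)/(a+1) of
-- the number of `t`-subsets, which drives both decay lemmas.
C-absorption′ : ∀ t a → suc a * ((t + suc a) C t) ≡ (t + suc a) * ((t + a) C t)
C-absorption′ t a = begin
  suc a * ((t + suc a) C t)
    ≡⟨ cong (suc a *_) (flip-C (suc a)) ⟩
  suc a * ((t + suc a) C suc a)
    ≡⟨ cong (λ z → suc a * (z C suc a)) (+-suc t a) ⟩
  suc a * (suc (t + a) C suc a)
    ≡⟨ C-absorption (t + a) a ⟩
  suc (t + a) * ((t + a) C a)
    ≡⟨ cong₂ _*_ (+-suc t a) (flip-C a) ⟨
  (t + suc a) * ((t + a) C t) ∎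
  where
  open ≡-Reasoning
  flip-C : ∀ b → (t + b) C t ≡ (t + b) C b
  flip-C b = trans (nCk≡nC[n∸k] (m≤m+n t b)) (cong ((t + b) C_) (m+n∸m≡n t b))

C-monoˡ-suc : ∀ n k → n C k ≤ suc n C k
C-monoˡ-suc n zero    = ≤-reflexive (trans (nC0≡1 n) (sym (nC0≡1 (suc n))))
C-monoˡ-suc n (suc k) = subst (n C suc k ≤_) (nCk+nC[k+1]≡[n+1]C[k+1] n k) (m≤n+m _ (n C k))

C-monoˡ : ∀ k {m n} → m ≤ n → m C k ≤ n C k
C-monoˡ k m≤n = go (≤⇒≤′ m≤n)
  where
  go : ∀ {m n} → m ≤′ n → m C k ≤ n C k
  go ≤′-refl = ≤-refl
  go {n = suc n} (≤′-step p) = ≤-trans (go p) (C-monoˡ-suc n k)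

C>0 : ∀ {n k} → k ≤ n → 0 < n C k
C>0 {n} {k} k≤n = subst (_≤ n C k) (nCn≡1 k) (C-monoˡ k k≤n)

-- (1 + 1/m)^r ≤ 1 + r/m + r²/m² for r ≤ m.
[m+1]^r≤ : ∀ m r → r ≤ m → (m * m) * suc m ^ r ≤ (m * m + r * m + r * r) * m ^ r
[m+1]^r≤ m zero r≤m = ≤-reflexive (eq m)
  where
  eq : ∀ m → (m * m) * 1 ≡ (m * m + 0 + 0) * 1
  eq = solve-∀
[m+1]^r≤ m (suc r) r<m = begin
  (m * m) * (suc m * suc m ^ r)                   ≡⟨ e₁ m (suc m ^ r) ⟩
  suc m * ((m * m) * suc m ^ r)                   ≤⟨ *-monoʳ-≤ (suc m) ([m+1]^r≤ m r (<⇒≤ r<m)) ⟩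
  suc m * ((m * m + r * m + r * r) * m ^ r)       ≡⟨ e₂ m r (m ^ r) ⟩
  (m * (m * m + r * m + r * r) + m * m + r * m + r * r) * m ^ r
    ≤⟨ *-monoˡ-≤ (m ^ r) (+-monoʳ-≤ (m * (m * m + r * m + r * r) + m * m + r * m) (*-monoʳ-≤ r (<⇒≤ r<m))) ⟩
  (m * (m * m + r * m + r * r) + m * m + r * m + r * m) * m ^ r
    ≤⟨ *-monoˡ-≤ (m ^ r) (m≤m+n (m * (m * m + r * m + r * r) + m * m + r * m + r * m) m) ⟩
  (m * (m * m + r * m + r * r) + m * m + r * m + r * m + m) * m ^ r
    ≡⟨ e₃ m r (m ^ r) ⟩
  (m * m + suc r * m + suc r * suc r) * (m * m ^ r) ∎
  where
  open ≤-Reasoning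
  e₁ : ∀ m x → (m * m) * (suc m * x) ≡ suc m * ((m * m) * x)
  e₁ = solve-∀
  e₂ : ∀ m r x → suc m * ((m * m + r * m + r * r) * x) ≡ (m * (m * m + r * m + r * r) + m * m + r * m + r * r) * x
  e₂ = solve-∀
  e₃ : ∀ m r x → (m * (m * m + r * m + r * r) + m * m + r * m + r * m + m) * x ≡ (m * m + suc r * m + suc r * suc r) * (m * x)
  e₃ = solve-∀

-- The case `r = m` of the quadratic estimate, whose three summands then coincide. The exponent was
-- separated from the base there because the induction needs a fixed base.
[1+m]^m≤3m^m : ∀ m .{{_ : NonZero m}} → suc m ^ m ≤ 3 * m ^ m
[1+m]^m≤3m^m m = *-cancelˡ-≤ (m * m) {{m*n≢0 m m}} (begin
  (m * m) * suc m ^ m                   ≤⟨ [m+1]^r≤ m m ≤-refl ⟩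
  (m * m + m * m + m * m) * m ^ m       ≡⟨ eq m (m ^ m) ⟩
  (m * m) * (3 * m ^ m)                 ∎)
  where
  open ≤-Reasoning
  eq : ∀ m x → (m * m + m * m + m * m) * x ≡ (m * m) * (3 * x)
  eq = solve-∀

-- The sum starts at index 1: in the applications term 0 is a full star, and only the error terms
-- above it are added up.
Σ₁ : (ℕ → ℕ) → ℕ → ℕ
Σ₁ x zero    = 0
Σ₁ x (suc j) = Σ₁ x j + x (suc j)

Σ₁-*ˡ : ∀ c x j → Σ₁ (λ a → c * x a) j ≡ c * Σ₁ x j
Σ₁-*ˡ c x zero    = sym (*-zeroʳ c)
Σ₁-*ˡ c x (suc j) = trans (cong (_+ c * x (suc j)) (Σ₁-*ˡ c x j)) (sym (*-distribˡ-+ c (Σ₁ x j) (x (suc j))))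

-- The ratio of consecutive terms is at most (3/16)(1 + 1/(a+1))^(a+1).
Decays : (ℕ → ℕ) → Set
Decays x = ∀ a → 16 * (suc a ^ suc a * x (suc a)) ≤ 3 * (suc (suc a) ^ suc a * x a)

module _ {x : ℕ → ℕ} (decays : Decays x) where

  private
    open ≤-Reasoning

    -- The uniform ratio 9/16 of `later` alone would give a total of 9/7. With only the first ratio
    -- exact the total is 6/7, too much beside the further 3/16 spent in `Bounds⇒<`. So the first
    -- two ratios, 3/8 and 27/64, are both kept exact.
    first : 8 * x 1 ≤ 3 * x 0
    first = *-cancelˡ-≤ 2 (begin
      2 * (8 * x 1)        ≡⟨ e₁ (x 1) ⟩
      16 * (1 * x 1)       ≤⟨ decays 0 ⟩
      3 * (2 * x 0)        ≡⟨ e₂ (x 0) ⟩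
      2 * (3 * x 0)        ∎)
      where
      e₁ : ∀ y → 2 * (8 * y) ≡ 16 * (1 * y)
      e₁ = solve-∀
      e₂ : ∀ y → 3 * (2 * y) ≡ 2 * (3 * y)
      e₂ = solve-∀

    second : 64 * x 2 ≤ 27 * x 1
    second = begin
      64 * x 2        ≡⟨ e₁ (x 2) ⟩
      16 * (4 * x 2)  ≤⟨ decays 1 ⟩
      3 * (9 * x 1)   ≡⟨ e₂ (x 1) ⟩
      27 * x 1        ∎
      where
      e₁ : ∀ y → 64 * y ≡ 16 * (4 * y)
      e₁ = solve-∀
      e₂ : ∀ y → 3 * (9 * y) ≡ 27 * y
      e₂ = solve-∀

    later : ∀ a → 16 * x (suc a) ≤ 9 * x a
    later a = *-cancelˡ-≤ (suc a ^ suc a) {{m^n≢0 (suc a) (suc a)}} (begin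
      suc a ^ suc a * (16 * x (suc a))    ≡⟨ e₁ (suc a ^ suc a) (x (suc a)) ⟩
      16 * (suc a ^ suc a * x (suc a))    ≤⟨ decays a ⟩
      3 * (suc (suc a) ^ suc a * x a)     ≤⟨ *-monoʳ-≤ 3 (*-monoˡ-≤ (x a) ([1+m]^m≤3m^m (suc a))) ⟩
      3 * (3 * suc a ^ suc a * x a)       ≡⟨ e₂ (suc a ^ suc a) (x a) ⟩
      suc a ^ suc a * (9 * x a)           ∎)
      where
      e₁ : ∀ p y → p * (16 * y) ≡ 16 * (p * y)
      e₁ = solve-∀
      e₂ : ∀ p y → 3 * (3 * p * y) ≡ p * (9 * y)
      e₂ = solve-∀

    -- The term with 36 makes the claim inductive: 36/28 = 9/7 is the sum of a geometric tail of
    -- ratio 9/16, so it reserves room for everything still to come. The constant is 55/28 = 1 +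
    -- (27/64)(16/7).
    tail : ∀ j → 28 * Σ₁ x (suc (suc j)) + 36 * x (suc (suc j)) ≤ 55 * x 1
    tail zero = begin
      28 * (0 + x 1 + x 2) + 36 * x 2   ≡⟨ e₁ (x 1) (x 2) ⟩
      28 * x 1 + 64 * x 2               ≤⟨ +-monoʳ-≤ (28 * x 1) second ⟩
      28 * x 1 + 27 * x 1               ≡⟨ e₂ (x 1) ⟩
      55 * x 1                          ∎
      where
      e₁ : ∀ y z → 28 * (0 + y + z) + 36 * z ≡ 28 * y + 64 * z
      e₁ = solve-∀
      e₂ : ∀ y → 28 * y + 27 * y ≡ 55 * y
      e₂ = solve-∀
    tail (suc j) = begin
      28 * (s + z) + 36 * z           ≡⟨ e₁ s z ⟩
      28 * s + 4 * (16 * z)           ≤⟨ +-monoʳ-≤ (28 * s) (*-monoʳ-≤ 4 (later (suc (suc j)))) ⟩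
      28 * s + 4 * (9 * y)            ≡⟨ cong (28 * s +_) (*-assoc 4 9 y) ⟨
      28 * s + 36 * y                 ≤⟨ tail j ⟩
      55 * x 1                        ∎
      where
      s y z : ℕ
      s = Σ₁ x (suc (suc j))
      y = x (suc (suc j))
      z = x (suc (suc (suc j)))
      e₁ : ∀ s z → 28 * (s + z) + 36 * z ≡ 28 * s + 4 * (16 * z)
      e₁ = solve-∀

    -- The product (55/28)(3/8) is 165/224, rounded up to 168/224 = 3/4.
    both : ∀ s → 28 * s ≤ 55 * x 1 → 4 * s ≤ 3 * x 0
    both s h = *-cancelˡ-≤ 56 (begin
      56 * (4 * s)           ≡⟨ e₁ s ⟩
      8 * (28 * s)           ≤⟨ *-monoʳ-≤ 8 h ⟩
      8 * (55 * x 1)         ≡⟨ e₂ (x 1) ⟩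
      55 * (8 * x 1)         ≤⟨ *-monoʳ-≤ 55 first ⟩
      55 * (3 * x 0)         ≤⟨ *-monoˡ-≤ (3 * x 0) (m≤m+n 55 1) ⟩
      56 * (3 * x 0)         ∎)
      where
      e₁ : ∀ y → 56 * (4 * y) ≡ 8 * (28 * y)
      e₁ = solve-∀
      e₂ : ∀ y → 8 * (55 * y) ≡ 55 * (8 * y)
      e₂ = solve-∀

  Σ₁-decays : ∀ j → 4 * Σ₁ x j ≤ 3 * x 0
  Σ₁-decays zero          = z≤n
  Σ₁-decays (suc zero)    = both (0 + x 1) (*-monoˡ-≤ (x 1) (m≤m+n 28 27))
  Σ₁-decays (suc (suc j)) = both (Σ₁ x (suc (suc j))) (≤-trans (m≤m+n (28 * Σ₁ x (suc (suc j))) (36 * x (suc (suc j)))) (tail j))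

module _ (t : ℕ) (f : ℕ → ℕ) where

  -- With f a the number of k-sets above a set of size t + a, levelTerm a bounds the number
  -- of members of F lying above the frontier sets of size t + a in the peeling.
  levelTerm : ℕ → ℕ
  levelTerm a = ((t + a) C t) * suc a ^ a * f a

  productTerm : ℕ → ℕ
  productTerm a = ((t + a) C t) * levelTerm a

  open ≤-Reasoning

  -- The denominator a + 1 of the binomial ratio joins `suc a ^ a` to form `suc a ^ suc a`; the
  -- numerator t + a + 1 is what the hypothesis has to absorb.
  levelTerm-decays : (∀ a → 16 * ((t + suc a) * f (suc a)) ≤ 3 * f a) → Decays levelTerm
  levelTerm-decays h a = begin
    16 * (suc a * s * (c′ * w * f (suc a)))       ≡⟨ e₁ (suc a) s c′ w (f (suc a)) ⟩
    s * w * 16 * (suc a * c′ * f (suc a))         ≡⟨ cong (λ z → s * w * 16 * (z * f (suc a))) (C-absorption′ t a) ⟩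
    s * w * 16 * ((t + suc a) * c * f (suc a))    ≡⟨ e₂ s w (t + suc a) c (f (suc a)) ⟩
    s * w * c * (16 * ((t + suc a) * f (suc a)))  ≤⟨ *-monoʳ-≤ (s * w * c) (h a) ⟩
    s * w * c * (3 * f a)                         ≡⟨ e₃ s w c (f a) ⟩
    3 * (w * (c * s * f a))                       ∎
    where
    s w c c′ : ℕ
    s = suc a ^ a
    w = suc (suc a) ^ suc a
    c = (t + a) C t
    c′ = (t + suc a) C t
    e₁ : ∀ b s c w y → 16 * (b * s * (c * w * y)) ≡ s * w * 16 * (b * c * y)
    e₁ = solve-∀
    e₂ : ∀ s w u c y → s * w * 16 * (u * c * y) ≡ s * w * c * (16 * (u * y))
    e₂ = solve-∀
    e₃ : ∀ s w c y → s * w * c * (3 * y) ≡ 3 * (w * (c * s * y))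
    e₃ = solve-∀

  -- The binomial ratio now enters squared. One of its two denominators a + 1 completes the power as
  -- before; the other is left over and appears on the right of the hypothesis.
  productTerm-decays : (∀ a → 16 * ((t + suc a) ^ 2 * f (suc a)) ≤ 3 * (suc a * f a)) → Decays productTerm
  productTerm-decays h a = *-cancelˡ-≤ (suc a) (begin
    suc a * (16 * (suc a * s * (c′ * (c′ * w * f (suc a)))))     ≡⟨ e₁ (suc a) s c′ w (f (suc a)) ⟩
    s * w * 16 * ((suc a * c′) * (suc a * c′) * f (suc a))       ≡⟨ cong (λ z → s * w * 16 * (z * z * f (suc a))) (C-absorption′ t a) ⟩
    s * w * 16 * ((u * c) * (u * c) * f (suc a))                 ≡⟨ e₂ s w u c (f (suc a)) ⟩
    s * w * c * c * (16 * (u ^ 2 * f (suc a)))                   ≤⟨ *-monoʳ-≤ (s * w * c * c) (h a) ⟩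
    s * w * c * c * (3 * (suc a * f a))                          ≡⟨ e₃ (suc a) s w c (f a) ⟩
    suc a * (3 * (w * (c * (c * s * f a))))                      ∎)
    where
    s w c c′ u : ℕ
    s = suc a ^ a
    w = suc (suc a) ^ suc a
    c = (t + a) C t
    c′ = (t + suc a) C t
    u = t + suc a
    e₁ : ∀ b s c w y → b * (16 * (b * s * (c * (c * w * y)))) ≡ s * w * 16 * ((b * c) * (b * c) * y)
    e₁ = solve-∀
    e₂ : ∀ s w u c y → s * w * 16 * ((u * c) * (u * c) * y) ≡ s * w * c * c * (16 * ((u * (u * 1)) * y))
    e₂ = solve-∀
    e₃ : ∀ b s w c y → s * w * c * c * (3 * (b * y)) ≡ b * (3 * (w * (c * (c * s * y))))
    e₃ = solve-∀

  -- From level 1 on the additional binomial is at least t + 1, hence at least 2. At level 0 it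
  -- equals 1, which is why only successor indices are compared.
  2levelTerm≤productTerm : 1 ≤ t → ∀ a → 2 * levelTerm (suc a) ≤ productTerm (suc a)
  2levelTerm≤productTerm 1≤t a = *-monoˡ-≤ (levelTerm (suc a)) (begin
    2                  ≤⟨ s≤s 1≤t ⟩
    suc t              ≡⟨ *-identityʳ (suc t) ⟨
    suc t * 1          ≡⟨ cong₂ _*_ (+-comm 1 t) (trans (sym (nCn≡1 t)) (cong (_C t) (sym (+-identityʳ t)))) ⟩
    (t + 1) * ((t + 0) C t)  ≡⟨ C-absorption′ t 0 ⟨
    1 * ((t + 1) C t)  ≡⟨ *-identityˡ _ ⟩
    (t + 1) C t        ≤⟨ C-monoˡ t (+-monoʳ-≤ t (s≤s z≤n)) ⟩
    (t + suc a) C t    ∎)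

Σ₁-mono₊ : ∀ {x y} → (∀ a → x (suc a) ≤ y (suc a)) → ∀ j → Σ₁ x j ≤ Σ₁ y j
Σ₁-mono₊ h zero    = z≤n
Σ₁-mono₊ h (suc j) = +-mono-≤ (Σ₁-mono₊ h j) (h j)

-- x ↦ (t + x)²/x is convex, so on 2 ≤ b ≤ m it is at most its value at b = 2 or at b = m.
square-bound : ∀ t m b {x y} → b ≤ m → 1 ≤ b →
  16 * ((t + 2) ^ 2 * x) ≤ 3 * y →
  16 * ((t + m) ^ 2 * x) ≤ 3 * (m * y) →
  16 * ((t + b) ^ 2 * x) ≤ 3 * (b * y)
square-bound t m (suc zero) {x} {y} _ _ h₂ _ = begin
  16 * ((t + 1) ^ 2 * x)   ≤⟨ *-monoʳ-≤ 16 (*-monoˡ-≤ x (^-monoˡ-≤ 2 (+-monoʳ-≤ t (s≤s z≤n)))) ⟩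
  16 * ((t + 2) ^ 2 * x)   ≤⟨ h₂ ⟩
  3 * y                    ≡⟨ cong (3 *_) (*-identityˡ y) ⟨
  3 * (1 * y)              ∎
  where open ≤-Reasoning
square-bound t m b@(suc (suc c)) {x} {y} b≤m _ h₂ hₘ with ≤-total (2 * b) (t * t)
-- The value at 2 minus the value at b is (b - 2)(t²/(2b) - 1), so the comparison of 2b with t²
-- decides its sign. The hypothesis at 2 has a factor 2 to spare, given away below.
... | inj₁ 2b≤t² = *-cancelˡ-≤ 2 (begin
  2 * (16 * ((t + b) ^ 2 * x))    ≡⟨ e₁ (t + b) x ⟩
  2 * ((t + b) * (t + b)) * (16 * x)   ≡⟨ cong (_* (16 * x)) (e₂ t c) ⟩
  (2 * (t * t) + 4 * (t * b) + 4 * b + c * (2 * b)) * (16 * x)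
     ≤⟨ *-monoˡ-≤ (16 * x) (+-monoʳ-≤ (2 * (t * t) + 4 * (t * b) + 4 * b) (*-monoʳ-≤ c 2b≤t²)) ⟩
  (2 * (t * t) + 4 * (t * b) + 4 * b + c * (t * t)) * (16 * x)   ≡⟨ e₃ t c x ⟩
  b * (16 * ((t + 2) ^ 2 * x))     ≤⟨ *-monoʳ-≤ b h₂ ⟩
  b * (3 * y)                      ≤⟨ m≤m+n (b * (3 * y)) (b * (3 * y)) ⟩
  b * (3 * y) + b * (3 * y)        ≡⟨ e₄ b y ⟩
  2 * (3 * (b * y))                ∎)
  where
  open ≤-Reasoning
  e₁ : ∀ u x → 2 * (16 * ((u * (u * 1)) * x)) ≡ 2 * (u * u) * (16 * x)
  e₁ = solve-∀
  e₂ : ∀ t c → 2 * ((t + suc (suc c)) * (t + suc (suc c))) ≡ 2 * (t * t) + 4 * (t * suc (suc c)) + 4 * suc (suc c) + c * (2 * suc (suc c))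
  e₂ = solve-∀
  e₃ : ∀ t c x → (2 * (t * t) + 4 * (t * suc (suc c)) + 4 * suc (suc c) + c * (t * t)) * (16 * x) ≡ suc (suc c) * (16 * (((t + 2) * ((t + 2) * 1)) * x))
  e₃ = solve-∀
  e₄ : ∀ b y → b * (3 * y) + b * (3 * y) ≡ 2 * (3 * (b * y))
  e₄ = solve-∀
... | inj₂ t²≤2b with m≤n⇒∃[o]m+o≡n b≤m
-- The value at m minus the value at b is (m - b)(1 - t²/(mb)), nonnegative because t² ≤ 2b and m is
-- at least 2.
... | e , refl = *-cancelˡ-≤ m (begin
  m * (16 * ((t + b) ^ 2 * x))     ≡⟨ e₁ t b e x ⟩
  (b * (t * t) + 2 * m * t * b + m * (b * b) + e * (t * t)) * (16 * x)
    ≤⟨ *-monoˡ-≤ (16 * x) (+-monoʳ-≤ (b * (t * t) + 2 * m * t * b + m * (b * b)) (*-monoʳ-≤ e t²≤mb)) ⟩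
  (b * (t * t) + 2 * m * t * b + m * (b * b) + e * (m * b)) * (16 * x) ≡⟨ e₃ t b e x ⟩
  b * (16 * ((t + m) ^ 2 * x))     ≤⟨ *-monoʳ-≤ b hₘ ⟩
  b * (3 * (m * y))                ≡⟨ e₄ m b y ⟩
  m * (3 * (b * y))                ∎)
  where
  open ≤-Reasoning
  t²≤mb : t * t ≤ m * b
  t²≤mb = ≤-trans t²≤2b (*-monoˡ-≤ b {2} {m} (s≤s (s≤s z≤n)))
  e₁ : ∀ t b e x → (b + e) * (16 * (((t + b) * ((t + b) * 1)) * x)) ≡ (b * (t * t) + 2 * (b + e) * t * b + (b + e) * (b * b) + e * (t * t)) * (16 * x)
  e₁ = solve-∀
  e₃ : ∀ t b e x → (b * (t * t) + 2 * (b + e) * t * b + (b + e) * (b * b) + e * ((b + e) * b)) * (16 * x) ≡ b * (16 * (((t + (b + e)) * ((t + (b + e)) * 1)) * x))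
  e₃ = solve-∀
  e₄ : ∀ m b y → b * (3 * (m * y)) ≡ m * (3 * (b * y))
  e₄ = solve-∀

-- Partial signed sets

-- Partial functions [n] → [q]: signed sets of any size.
PSet : ℕ → ℕ → Set
PSet n q = Vec (Maybe (Fin q)) n

∣_∣ᵖ : PSet n q → ℕ
∣ [] ∣ᵖ          = 0
∣ nothing ∷ X ∣ᵖ = ∣ X ∣ᵖ
∣ just _ ∷ X ∣ᵖ  = suc ∣ X ∣ᵖ

infix 4 _≼_

data _≼_ {q} : PSet n q → PSet n q → Set where
  []   : [] ≼ []
  skip : {X Y : PSet n q} (y : Maybe (Fin q)) → X ≼ Y → nothing ∷ X ≼ y ∷ Y
  keep : {X Y : PSet n q} (a : Fin q) → X ≼ Y → just a ∷ X ≼ just a ∷ Y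

agr : PSet n q → PSet n q → ℕ
agr [] [] = 0
agr (nothing ∷ X) (_ ∷ Y) = agr X Y
agr (just a ∷ X) (nothing ∷ Y) = agr X Y
agr (just a ∷ X) (just b ∷ Y) with a ≟ b
... | yes _ = suc (agr X Y)
... | no _  = agr X Y

≼-refl : (X : PSet n q) → X ≼ X
≼-refl []            = []
≼-refl (nothing ∷ X) = skip nothing (≼-refl X)
≼-refl (just a ∷ X)  = keep a (≼-refl X)

≼-trans : {X Y Z : PSet n q} → X ≼ Y → Y ≼ Z → X ≼ Z
≼-trans [] [] = []
≼-trans (skip _ p) (skip y r) = skip y (≼-trans p r)
≼-trans (skip _ p) (keep a r) = skip (just a) (≼-trans p r)
≼-trans (keep a p) (keep a r) = keep a (≼-trans p r)

_≼?_ : (X Y : PSet n q) → Dec (X ≼ Y)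
[] ≼? [] = yes []
(nothing ∷ X) ≼? (y ∷ Y) with X ≼? Y
... | yes p = yes (skip y p)
... | no ¬p = no λ { (skip _ p) → ¬p p }
(just a ∷ X) ≼? (nothing ∷ Y) = no λ ()
(just a ∷ X) ≼? (just b ∷ Y) with a ≟ b | X ≼? Y
... | yes refl | yes p = yes (keep a p)
... | yes refl | no ¬p = no λ { (keep _ p) → ¬p p }
... | no a≢b   | _     = no λ { (keep _ _) → a≢b refl }

≼⇒∣∣≤ : {X Y : PSet n q} → X ≼ Y → ∣ X ∣ᵖ ≤ ∣ Y ∣ᵖ
≼⇒∣∣≤ []                 = z≤n
≼⇒∣∣≤ (skip nothing p)   = ≼⇒∣∣≤ p
≼⇒∣∣≤ (skip (just _) p)  = m≤n⇒m≤1+n (≼⇒∣∣≤ p)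
≼⇒∣∣≤ (keep a p)         = s≤s (≼⇒∣∣≤ p)

≼∧∣∣≥⇒≡ : {X Y : PSet n q} → X ≼ Y → ∣ Y ∣ᵖ ≤ ∣ X ∣ᵖ → X ≡ Y
≼∧∣∣≥⇒≡ []                _       = refl
≼∧∣∣≥⇒≡ (skip nothing p)  h       = cong (nothing ∷_) (≼∧∣∣≥⇒≡ p h)
≼∧∣∣≥⇒≡ (skip (just _) p) h       = contradiction (≼⇒∣∣≤ p) (<⇒≱ h)
≼∧∣∣≥⇒≡ (keep a p)        (s≤s h) = cong (just a ∷_) (≼∧∣∣≥⇒≡ p h)

agr-comm : (X Y : PSet n q) → agr X Y ≡ agr Y X
agr-comm [] [] = refl
agr-comm (nothing ∷ X) (nothing ∷ Y) = agr-comm X Y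
agr-comm (nothing ∷ X) (just _ ∷ Y)  = agr-comm X Y
agr-comm (just _ ∷ X) (nothing ∷ Y)  = agr-comm X Y
agr-comm (just a ∷ X) (just b ∷ Y) with a ≟ b | b ≟ a
... | yes _ | yes _ = cong suc (agr-comm X Y)
... | no _  | no _  = agr-comm X Y
... | yes p | no ¬p = contradiction (sym p) ¬p
... | no ¬p | yes p = contradiction (sym p) ¬p

agr-refl : (X : PSet n q) → agr X X ≡ ∣ X ∣ᵖ
agr-refl []            = refl
agr-refl (nothing ∷ X) = agr-refl X
agr-refl (just a ∷ X) with a ≟ a
... | yes _  = cong suc (agr-refl X)
... | no a≢a = contradiction refl a≢a

agr≤∣∣ʳ : (X Y : PSet n q) → agr X Y ≤ ∣ Y ∣ᵖ
agr≤∣∣ʳ [] [] = z≤n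
agr≤∣∣ʳ (nothing ∷ X) (nothing ∷ Y) = agr≤∣∣ʳ X Y
agr≤∣∣ʳ (nothing ∷ X) (just b ∷ Y)  = m≤n⇒m≤1+n (agr≤∣∣ʳ X Y)
agr≤∣∣ʳ (just a ∷ X) (nothing ∷ Y)  = agr≤∣∣ʳ X Y
agr≤∣∣ʳ (just a ∷ X) (just b ∷ Y) with a ≟ b
... | yes _ = s≤s (agr≤∣∣ʳ X Y)
... | no _  = m≤n⇒m≤1+n (agr≤∣∣ʳ X Y)

agr-monoˡ : {X X′ : PSet n q} → X ≼ X′ → ∀ Y → agr X Y ≤ agr X′ Y
agr-monoˡ [] [] = z≤n
agr-monoˡ (skip nothing p)  (_ ∷ Y) = agr-monoˡ p Y
agr-monoˡ (skip (just a) p) (nothing ∷ Y) = agr-monoˡ p Y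
agr-monoˡ (skip (just a) p) (just b ∷ Y) with a ≟ b
... | yes _ = m≤n⇒m≤1+n (agr-monoˡ p Y)
... | no _  = agr-monoˡ p Y
agr-monoˡ (keep a p) (nothing ∷ Y) = agr-monoˡ p Y
agr-monoˡ (keep a p) (just b ∷ Y) with a ≟ b
... | yes _ = s≤s (agr-monoˡ p Y)
... | no _  = agr-monoˡ p Y

agr-monoʳ : ∀ X {Y Y′ : PSet n q} → Y ≼ Y′ → agr X Y ≤ agr X Y′
agr-monoʳ X {Y} {Y′} p = subst₂ _≤_ (agr-comm Y X) (agr-comm Y′ X) (agr-monoˡ p X)

≼⇒∣∣≤agr : {X Y : PSet n q} → X ≼ Y → ∣ X ∣ᵖ ≤ agr X Y
≼⇒∣∣≤agr {X = X} p = ≤-trans (≤-reflexive (sym (agr-refl X))) (agr-monoʳ X p)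

∣∣≤agr⇒≼ : (X Y : PSet n q) → ∣ X ∣ᵖ ≤ agr X Y → X ≼ Y
∣∣≤agr⇒≼ [] [] _ = []
∣∣≤agr⇒≼ (nothing ∷ X) (y ∷ Y) h = skip y (∣∣≤agr⇒≼ X Y h)
∣∣≤agr⇒≼ (just a ∷ X) (nothing ∷ Y) h =
  contradiction (subst (_≤ ∣ X ∣ᵖ) (agr-comm Y X) (agr≤∣∣ʳ Y X)) (<⇒≱ h)
∣∣≤agr⇒≼ (just a ∷ X) (just b ∷ Y) h with a ≟ b
∣∣≤agr⇒≼ (just a ∷ X) (just b ∷ Y) (s≤s h) | yes refl = keep a (∣∣≤agr⇒≼ X Y h)
... | no _ = contradiction (subst (_≤ ∣ X ∣ᵖ) (agr-comm Y X) (agr≤∣∣ʳ Y X)) (<⇒≱ h)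

Meets : ℕ → List (PSet n q) → PSet n q → Set
Meets t B W = All (λ T → t ≤ agr W T) B

Above : List (PSet n q) → PSet n q → Set
Above K W = Any (_≼ W) K

Covers : List (PSet n q) → List (PSet n q) → Set
Covers K A = All (Above K) A

Above-map : ∀ {m} {K : List (PSet n q)} {W} y → (∀ {X} → X ≼ W → m ∷ X ≼ y ∷ W) →
  Above K W → Above (map (m ∷_) K) (y ∷ W)
Above-map y f = Any.map⁺ ∘ Any.map f

subsets : ℕ → PSet n q → List (PSet n q)
subsets zero    []            = [] ∷ []
subsets (suc t) []            = []
subsets t       (nothing ∷ B) = map (nothing ∷_) (subsets t B)
subsets zero    (just a ∷ B)  = map (nothing ∷_) (subsets zero B)
subsets (suc t) (just a ∷ B)  = map (just a ∷_) (subsets t B) ++ map (nothing ∷_) (subsets (suc t) B)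

length-subsets : ∀ t (B : PSet n q) → length (subsets t B) ≡ ∣ B ∣ᵖ C t
length-subsets zero    []            = refl
length-subsets (suc t) []            = sym (k>n⇒nCk≡0 {0} {suc t} (s≤s z≤n))
length-subsets zero    (nothing ∷ B) = trans (length-map _ (subsets zero B)) (length-subsets zero B)
length-subsets (suc t) (nothing ∷ B) = trans (length-map _ (subsets (suc t) B)) (length-subsets (suc t) B)
length-subsets zero    (just a ∷ B)  = begin
  length (map (nothing ∷_) (subsets zero B)) ≡⟨ length-map _ (subsets zero B) ⟩
  length (subsets zero B)                    ≡⟨ length-subsets zero B ⟩
  ∣ B ∣ᵖ C 0                                 ≡⟨ nC0≡1 ∣ B ∣ᵖ ⟩
  1                                          ≡⟨ nC0≡1 (suc ∣ B ∣ᵖ) ⟨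
  suc ∣ B ∣ᵖ C 0                             ∎
  where open ≡-Reasoning
length-subsets (suc t) (just a ∷ B)  = begin
  length (map (just a ∷_) (subsets t B) ++ map (nothing ∷_) (subsets (suc t) B))
    ≡⟨ length-++ (map (just a ∷_) (subsets t B)) ⟩
  length (map (just a ∷_) (subsets t B)) + length (map (nothing ∷_) (subsets (suc t) B))
    ≡⟨ cong₂ _+_ (trans (length-map _ (subsets t B)) (length-subsets t B))
                 (trans (length-map _ (subsets (suc t) B)) (length-subsets (suc t) B)) ⟩
  (∣ B ∣ᵖ C t) + (∣ B ∣ᵖ C suc t)
    ≡⟨ nCk+nC[k+1]≡[n+1]C[k+1] ∣ B ∣ᵖ t ⟩
  suc ∣ B ∣ᵖ C suc t ∎
  where open ≡-Reasoning

subsets-size : ∀ t (B : PSet n q) → All (λ X → ∣ X ∣ᵖ ≡ t) (subsets t B)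
subsets-size zero    []            = refl ∷ []
subsets-size (suc t) []            = []
subsets-size zero    (nothing ∷ B) = All.map⁺ (subsets-size zero B)
subsets-size (suc t) (nothing ∷ B) = All.map⁺ (subsets-size (suc t) B)
subsets-size zero    (just a ∷ B)  = All.map⁺ (subsets-size zero B)
subsets-size (suc t) (just a ∷ B)  =
  All.++⁺ (All.map⁺ (All.map (cong suc) (subsets-size t B))) (All.map⁺ (subsets-size (suc t) B))

subsets-above : ∀ t (B W : PSet n q) → t ≤ agr W B → Above (subsets t B) W
subsets-above zero    [] [] _ = here []
subsets-above (suc t) [] [] ()
subsets-above zero    (nothing ∷ B) (w ∷ W) h = Above-map w (skip w) (subsets-above zero B W z≤n)
subsets-above (suc t) (nothing ∷ B) (nothing ∷ W) h = Above-map _ (skip _) (subsets-above (suc t) B W h)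
subsets-above (suc t) (nothing ∷ B) (just w ∷ W) h = Above-map _ (skip _) (subsets-above (suc t) B W h)
subsets-above zero    (just a ∷ B) (w ∷ W) h = Above-map w (skip w) (subsets-above zero B W z≤n)
subsets-above (suc t) (just a ∷ B) (nothing ∷ W) h =
  Any.++⁺ʳ _ (Above-map _ (skip _) (subsets-above (suc t) B W h))
subsets-above (suc t) (just a ∷ B) (just b ∷ W) h with b ≟ a
subsets-above (suc t) (just a ∷ B) (just b ∷ W) (s≤s h) | yes refl =
  Any.++⁺ˡ (Above-map _ (keep a) (subsets-above t B W h))
... | no _ = Any.++⁺ʳ _ (Above-map _ (skip _) (subsets-above (suc t) B W h))

-- The first c (or all, if fewer) one-point extensions of X by points of T.
extensions : ℕ → PSet n q → PSet n q → List (PSet n q)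
extensions zero    _ _ = []
extensions (suc c) [] [] = []
extensions (suc c) (nothing ∷ X) (nothing ∷ T) = map (nothing ∷_) (extensions (suc c) X T)
extensions (suc c) (nothing ∷ X) (just a ∷ T)  = (just a ∷ X) ∷ map (nothing ∷_) (extensions c X T)
extensions (suc c) (just b ∷ X)  (_ ∷ T)       = map (just b ∷_) (extensions (suc c) X T)

length-extensions : ∀ c (X T : PSet n q) → length (extensions c X T) ≤ c
length-extensions zero    _ _ = z≤n
length-extensions (suc c) [] [] = z≤n
length-extensions (suc c) (nothing ∷ X) (nothing ∷ T) =
  subst (_≤ suc c) (sym (length-map _ (extensions (suc c) X T))) (length-extensions (suc c) X T)
length-extensions (suc c) (nothing ∷ X) (just a ∷ T) =
  s≤s (subst (_≤ c) (sym (length-map _ (extensions c X T))) (length-extensions c X T))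
length-extensions (suc c) (just b ∷ X) (_ ∷ T) =
  subst (_≤ suc c) (sym (length-map _ (extensions (suc c) X T))) (length-extensions (suc c) X T)

extensions-size : ∀ c (X T : PSet n q) → All (λ Y → ∣ Y ∣ᵖ ≡ suc ∣ X ∣ᵖ) (extensions c X T)
extensions-size zero    _ _ = []
extensions-size (suc c) [] [] = []
extensions-size (suc c) (nothing ∷ X) (nothing ∷ T) = All.map⁺ (extensions-size (suc c) X T)
extensions-size (suc c) (nothing ∷ X) (just a ∷ T)  = refl ∷ All.map⁺ (extensions-size c X T)
extensions-size (suc c) (just b ∷ X)  (_ ∷ T)       = All.map⁺ (All.map (cong suc) (extensions-size (suc c) X T))

-- W misses at most |T| − agr W T < c points of T, so it contains one of any c points of T.
extensions-above : ∀ c {X W : PSet n q} T → X ≼ W → ∣ T ∣ᵖ < agr W T + c → agr X T < agr W T →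
  Above (extensions c X T) W
extensions-above zero {W = W} T p h _ =
  contradiction (subst (∣ T ∣ᵖ <_) (+-identityʳ (agr W T)) h) (≤⇒≯ (agr≤∣∣ʳ W T))
extensions-above (suc c) [] [] h ()
extensions-above (suc c) (nothing ∷ T) (skip nothing p) h l = Above-map _ (skip _) (extensions-above (suc c) T p h l)
extensions-above (suc c) (nothing ∷ T) (skip (just b) p) h l = Above-map _ (skip _) (extensions-above (suc c) T p h l)
extensions-above (suc c) (nothing ∷ T) (keep b p) h l = Above-map _ (keep b) (extensions-above (suc c) T p h l)
extensions-above (suc c) {W = _ ∷ W} (just a ∷ T) (skip nothing p) h l =
  there (Above-map _ (skip _) (extensions-above c T p (s≤s⁻¹ (subst (suc (suc ∣ T ∣ᵖ) ≤_) (+-suc (agr W T) c) h)) l))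
extensions-above (suc c) {W = _ ∷ W} (just a ∷ T) (skip (just b) p) h l with b ≟ a
... | yes refl = here (keep a p)
... | no _ = there (Above-map _ (skip _) (extensions-above c T p (s≤s⁻¹ (subst (suc (suc ∣ T ∣ᵖ) ≤_) (+-suc (agr W T) c) h)) l))
extensions-above (suc c) (just a ∷ T) (keep b p) h l with b ≟ a
... | yes _ = Above-map _ (keep b) (extensions-above (suc c) T p (s≤s⁻¹ h) (s≤s⁻¹ l))
... | no _  = Above-map _ (keep b) (extensions-above (suc c) T p (<-trans (n<1+n _) h) l)

-- Peeling

Meets? : ∀ t (B : List (PSet n q)) W → Dec (Meets t B W)
Meets? t B W = all? (λ T → t ≤? agr W T) B

Meets-flip : ∀ {t} {A B : List (PSet n q)} → All (Meets t B) A → All (Meets t A) B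
Meets-flip {t = t} h = All.tabulate λ {T} T∈B → All.tabulate λ {W} W∈A →
  subst (t ≤_) (agr-comm W T) (All.lookup (All.lookup h W∈A) T∈B)

Above-upward : ∀ {K} {W W′ : PSet n q} → W ≼ W′ → Above K W → Above K W′
Above-upward p = Any.map (λ r → ≼-trans r p)

Above-trans : ∀ {K A} {W : PSet n q} → Covers K A → Above A W → Above K W
Above-trans h W↑ with find W↑
... | X , X∈A , X≼W = Above-upward X≼W (All.lookup h X∈A)

-- Outcome of growing the sets Xs until they either meet all of B in t points or reach size s.
record Branching {n q} (t : ℕ) (B Xs : List (PSet n q)) (s N : ℕ) : Set where
  field
    stopped frontier : List (PSet n q)
    above           : ∀ {W} → Meets t B W → Above Xs W → Above stopped W ⊎ Above frontier W
    stopped-meets   : All (Meets t B) stopped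
    stopped-size    : All (λ X → ∣ X ∣ᵖ < s) stopped
    frontier-size   : All (λ X → ∣ X ∣ᵖ ≡ s) frontier
    frontier-length : length frontier ≤ N

open Branching

branch-once : ∀ {t c s} {B : List (PSet n q)} → All (λ T → ∣ T ∣ᵖ < t + c) B →
  ∀ {Xs} → All (λ X → ∣ X ∣ᵖ ≡ s) Xs → Branching t B Xs (suc s) (length Xs * c)
branch-once small [] = record
  { stopped = [] ; frontier = [] ; above = λ _ () ; stopped-meets = [] ; stopped-size = []
  ; frontier-size = [] ; frontier-length = z≤n }
branch-once {t = t} {c} {B = B} small {X ∷ Xs} (refl ∷ sizes) with branch-once {t = t} {c} small sizes | Meets? t B X
... | R | yes m = record
  { stopped = X ∷ stopped R
  ; frontier = frontier R
  ; above = λ { _ (here p) → inj₁ (here p)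
              ; h (there p) → map₁ there (above R h p) }
  ; stopped-meets = m ∷ stopped-meets R
  ; stopped-size = ≤-refl ∷ stopped-size R
  ; frontier-size = frontier-size R
  ; frontier-length = m≤n⇒m≤o+n c (frontier-length R)
  }
... | R | no ¬m with find (All.¬All⇒Any¬ (λ T → t ≤? agr X T) B ¬m)
... | T , T∈B , t≰ = record
  { stopped = stopped R
  ; frontier = extensions c X T ++ frontier R
  ; above = λ { {W} h (here p) → inj₂ (Any.++⁺ˡ (extensions-above c T p
                  (<-≤-trans (All.lookup small T∈B) (+-monoˡ-≤ c (All.lookup h T∈B)))
                  (<-≤-trans (≰⇒> t≰) (All.lookup h T∈B))))
              ; h (there p) → map₂ (Any.++⁺ʳ _) (above R h p) }
  ; stopped-meets = stopped-meets R
  ; stopped-size = stopped-size R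
  ; frontier-size = All.++⁺ (extensions-size c X T) (frontier-size R)
  ; frontier-length = subst (_≤ c + length Xs * c) (sym (length-++ (extensions c X T)))
      (+-mono-≤ (length-extensions c X T) (frontier-length R))
  }

branch : ∀ {t c s} {B : List (PSet n q)} → All (λ T → ∣ T ∣ᵖ < t + c) B →
  ∀ r {Xs} → All (λ X → ∣ X ∣ᵖ ≡ s) Xs → Branching t B Xs (s + r) (length Xs * c ^ r)
branch {s = s} small zero {Xs} sizes = record
  { stopped = [] ; frontier = Xs ; above = λ _ → inj₂ ; stopped-meets = [] ; stopped-size = []
  ; frontier-size = All.map (λ e → trans e (sym (+-identityʳ s))) sizes
  ; frontier-length = ≤-reflexive (sym (*-identityʳ (length Xs))) }
branch {t = t} {c} {s} small (suc r) {Xs} sizes = record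
  { stopped = stopped R₁ ++ stopped R₂
  ; frontier = frontier R₂
  ; above = λ h p → [ inj₁ ∘ Any.++⁺ˡ , map₁ (Any.++⁺ʳ (stopped R₁)) ∘ above R₂ h ]′ (above R₁ h p)
  ; stopped-meets = All.++⁺ (stopped-meets R₁) (stopped-meets R₂)
  ; stopped-size = All.++⁺
      (All.map (λ l → <-≤-trans l (subst (suc s ≤_) (sym (+-suc s r)) (s≤s (m≤m+n s r)))) (stopped-size R₁))
      (All.map (λ {X} l → subst (∣ X ∣ᵖ <_) (sym (+-suc s r)) l) (stopped-size R₂))
  ; frontier-size = All.map (λ e → trans e (sym (+-suc s r))) (frontier-size R₂)
  ; frontier-length = ≤-trans (frontier-length R₂)
      (≤-trans (*-monoˡ-≤ (c ^ r) (frontier-length R₁)) (≤-reflexive (*-assoc (length Xs) c (c ^ r))))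
  }
  where
  R₁ = branch-once {t = t} {c} small sizes
  R₂ = branch {t = t} {c} small r (frontier-size R₁)

-- With `f s` the number of k-sets above a set of size s, this is the union bound for a family of
-- k-sets covered by the list.
cost : (ℕ → ℕ) → List (PSet n q) → ℕ
cost f K = sum (map (f ∘ ∣_∣ᵖ) K)

cost-++ : ∀ f (K L : List (PSet n q)) → cost f (K ++ L) ≡ cost f K + cost f L
cost-++ f []      L = refl
cost-++ f (X ∷ K) L = trans (cong (f ∣ X ∣ᵖ +_) (cost-++ f K L)) (sym (+-assoc (f ∣ X ∣ᵖ) _ _))

cost-uniform : ∀ f {s N} {K : List (PSet n q)} → All (λ X → ∣ X ∣ᵖ ≡ s) K → length K ≤ N → cost f K ≤ N * f s
cost-uniform f {s} {N} {K} sizes l = ≤-trans (≤-reflexive (eq sizes)) (*-monoˡ-≤ (f s) l)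
  where
  eq : ∀ {K : List (PSet _ _)} → All (λ X → ∣ X ∣ᵖ ≡ s) K → cost f K ≡ length K * f s
  eq []             = refl
  eq (refl ∷ sizes) = cong (f s +_) (eq sizes)

levelSum productSum : ℕ → (ℕ → ℕ) → ℕ → ℕ
levelSum t f   = Σ₁ (levelTerm t (f ∘ (t +_)))
productSum t f = Σ₁ (productTerm t (f ∘ (t +_)))

-- The two ways the peeling ends: one new list is empty (c bounds the number of t-subsets of
-- a member of the other), or both new lists lie above a t-set Y that some old set avoids.
Bounds : ℕ → (f g : ℕ → ℕ) → ℕ → ℕ → ℕ → Set
Bounds t f g j x y =
  (Σ ℕ λ c → c ≤ (t + j) C t × x ≤ levelSum t f j × c * x ≤ productSum t f j × y ≤ levelSum t g j + c * g t)
  ⊎ (x ≤ levelSum t f j + suc j * f (suc t) × y ≤ levelSum t g j + g t)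

-- Returning one level up adds the two frontiers. The stored `c` comes from the deeper level where
-- the peeling ended, and the binomials grow with the level, so `c` times a frontier added later
-- still fits into that level's own product term.
Bounds-suc : ∀ t f g j {x x′ y y′} →
  x′ ≤ levelTerm t (f ∘ (t +_)) (suc j) → y′ ≤ levelTerm t (g ∘ (t +_)) (suc j) →
  Bounds t f g j x y → Bounds t f g (suc j) (x + x′) (y + y′)
Bounds-suc t f g j {x} {x′} {y} {y′} hx hy (inj₁ (c , c≤ , x≤ , cx≤ , y≤)) =
  inj₁ (c , c≤C , +-mono-≤ x≤ hx
       , subst (_≤ productSum t f (suc j)) (sym (*-distribˡ-+ c x x′)) (+-mono-≤ cx≤ (*-mono-≤ c≤C hx))
       , ≤-trans (+-mono-≤ y≤ hy) (≤-reflexive (eq (levelSum t g j) (c * g t) _)))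
  where
  c≤C : c ≤ (t + suc j) C t
  c≤C = ≤-trans c≤ (C-monoˡ t (+-monoʳ-≤ t (n≤1+n j)))
  eq : ∀ a b c → a + b + c ≡ a + c + b
  eq = solve-∀
Bounds-suc t f g j {x} {x′} {y} {y′} hx hy (inj₂ (x≤ , y≤)) =
  inj₂ ( ≤-trans (+-mono-≤ x≤ hx) (≤-trans (≤-reflexive (eq (levelSum t f j) (suc j * f (suc t)) _))
           (+-monoʳ-≤ (levelSum t f (suc j)) (*-monoˡ-≤ (f (suc t)) (n≤1+n (suc j)))))
       , ≤-trans (+-mono-≤ y≤ hy) (≤-reflexive (eq (levelSum t g j) (g t) _)))
  where
  eq : ∀ a b c → a + b + c ≡ a + c + b
  eq = solve-∀

Nontrivial : ℕ → (A B : List (PSet n q)) → Set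
Nontrivial {n} {q} t A B = (Y : PSet n q) → ∣ Y ∣ᵖ ≡ t → All (Y ≼_) A → All (Y ≼_) B → ⊥

Trivial : ℕ → (A B : List (PSet n q)) → Set
Trivial {n} {q} t A B = Σ (PSet n q) λ Y → ∣ Y ∣ᵖ ≡ t × All (Y ≼_) A × All (Y ≼_) B

-- A common `Y` must lie below `A₀`, so a search through the `t`-subsets of `A₀` decides the
-- question. None is missed: a listed set below `Y` of the same size is `Y`.
trivial-or-not : ∀ t (A₀ : PSet n q) As B → Trivial t (A₀ ∷ As) B ⊎ Nontrivial t (A₀ ∷ As) B
trivial-or-not t A₀ As B
  with any? (λ Y → all? (Y ≼?_) (A₀ ∷ As) ×-dec all? (Y ≼?_) B) (subsets t A₀)
... | yes p with find p
... | Y , Y∈ , (a , b) = inj₁ (Y , All.lookup (subsets-size t A₀) Y∈ , a , b)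
trivial-or-not t A₀ As B | no ¬p = inj₂ none
  where
  none : Nontrivial t (A₀ ∷ As) B
  none Y refl (Y≼A₀ ∷ a) b
    with find (subsets-above t A₀ Y (≼⇒∣∣≤agr Y≼A₀))
  ... | Z , Z∈ , Z≼Y with ≼∧∣∣≥⇒≡ Z≼Y (≤-reflexive (sym (All.lookup (subsets-size t A₀) Z∈)))
  ... | refl = ¬p (lose Z∈ (Y≼A₀ ∷ a , b))

record Peeled {n q} (t : ℕ) (f g : ℕ → ℕ) (j : ℕ) (A B : List (PSet n q)) : Set where
  constructor peeled
  field
    coverA coverB : List (PSet n q)
    coversA       : Covers coverA A
    coversB       : Covers coverB B
    bounds        : Bounds t f g j (cost f coverA) (cost g coverB) ⊎ Bounds t g f j (cost g coverB) (cost f coverA)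

peel : ∀ {t f g} → 1 ≤ t → ∀ j {A B : List (PSet n q)} {A₀ B₀} → A₀ ∈ˡ A → B₀ ∈ˡ B →
  All (λ X → ∣ X ∣ᵖ ≤ t + j) A → All (λ X → ∣ X ∣ᵖ ≤ t + j) B →
  All (Meets t B) A → Nontrivial t A B → Peeled t f g j A B
-- At level 0 all sets have size at most t yet agree pairwise in t places, so all are one and the
-- same `t`-set. Nontriviality forbids this, and no bound has to be produced.
peel {t = t} 1≤t zero {A} {B} {A₀} {B₀} A₀∈A B₀∈B smallA smallB cross nontrivial =
  ⊥-elim (nontrivial B₀ ∣B₀∣≡t B₀≼A (All.map (≼-trans (All.lookup B₀≼A A₀∈A)) A₀≼B))
  where
  ≤t : ∀ {C} {X : PSet _ _} → All (λ X → ∣ X ∣ᵖ ≤ t + 0) C → X ∈ˡ C → ∣ X ∣ᵖ ≤ t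
  ≤t {X = X} small X∈C = subst (∣ X ∣ᵖ ≤_) (+-identityʳ t) (All.lookup small X∈C)
  B₀≼A : All (B₀ ≼_) A
  B₀≼A = All.map (λ {W} h → ∣∣≤agr⇒≼ B₀ W (≤-trans (≤t smallB B₀∈B) h)) (All.lookup (Meets-flip cross) B₀∈B)
  A₀≼B : All (A₀ ≼_) B
  A₀≼B = All.map (λ {T} h → ∣∣≤agr⇒≼ A₀ T (≤-trans (≤t smallA A₀∈A) h)) (All.lookup cross A₀∈A)
  ∣B₀∣≡t : ∣ B₀ ∣ᵖ ≡ t
  ∣B₀∣≡t = ≤-antisym (≤t smallB B₀∈B) (≤-trans (All.lookup (All.lookup cross A₀∈A) B₀∈B) (agr≤∣∣ʳ A₀ B₀))
peel {n} {q} {t = t} {f} {g} 1≤t (suc j) {A} {B} {A₀} {B₀} A₀∈A B₀∈B smallA smallB cross nontrivial = result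
  where
  c = (t + suc j) C t
  lt : ∀ {C : List (PSet n q)} → All (λ X → ∣ X ∣ᵖ ≤ t + suc j) C → All (λ X → ∣ X ∣ᵖ < t + suc (suc j)) C
  lt = All.map (λ {X} h → subst (∣ X ∣ᵖ <_) (sym (+-suc t (suc j))) (s≤s h))
  flipped = Meets-flip cross

  length-subsets≤ : ∀ {X : PSet n q} → ∣ X ∣ᵖ ≤ t + suc j → length (subsets t X) ≤ c
  length-subsets≤ {X} h = ≤-trans (≤-reflexive (length-subsets t X)) (C-monoˡ t h)

  level : ∀ h {D} {X : PSet n q} → ∣ X ∣ᵖ ≤ t + suc j →
    (R : Branching t D (subsets t X) (t + suc j) (length (subsets t X) * suc (suc j) ^ suc j)) →
    cost h (frontier R) ≤ levelTerm t (h ∘ (t +_)) (suc j)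
  level h small R = cost-uniform h (frontier-size R)
    (≤-trans (frontier-length R) (*-monoˡ-≤ (suc (suc j) ^ suc j) (length-subsets≤ small)))

  subsets-cover : ∀ {C D : List (PSet n q)} {X} → X ∈ˡ D → All (Meets t D) C → Covers (subsets t X) C
  subsets-cover {X = X} X∈D = All.map (λ {W} m → subsets-above t X W (All.lookup m X∈D))

  base : ∀ f {x} → x ≤ levelTerm t (f ∘ (t +_)) (suc j) → x ≤ levelSum t f (suc j)
  base f h = ≤-trans h (m≤n+m _ (levelSum t f j))

  first : ∀ f g {x y} → x ≤ levelTerm t (f ∘ (t +_)) (suc j) → y ≤ c * g t → Bounds t f g (suc j) x y
  first f g {x} hx hy = inj₁ (c , ≤-refl , base f hx
    , ≤-trans (*-monoʳ-≤ c hx) (m≤n+m _ (productSum t f j))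
    , ≤-trans hy (m≤n+m _ (levelSum t g (suc j))))

  extend : ∀ {Y D W : PSet n q} → ∣ Y ∣ᵖ ≡ t → ∣ D ∣ᵖ ≤ t + suc j → ¬ Y ≼ D → Y ≼ W → t ≤ agr W D →
    Above (extensions (suc (suc j)) Y D) W
  extend {Y} {D} {W} refl small Y⋠D Y≼W m = extensions-above (suc (suc j)) D Y≼W
    (<-≤-trans (subst (∣ D ∣ᵖ <_) (sym (+-suc t (suc j))) (s≤s small)) (+-monoˡ-≤ (suc (suc j)) m))
    (<-≤-trans (≰⇒> (λ h → Y⋠D (∣∣≤agr⇒≼ Y D h))) m)

  second : ∀ f g {K L : List (PSet n q)} Y D → ∣ Y ∣ᵖ ≡ t →
    cost f K ≤ levelTerm t (f ∘ (t +_)) (suc j) → cost g L ≤ levelTerm t (g ∘ (t +_)) (suc j) →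
    Bounds t f g (suc j) (cost f (extensions (suc (suc j)) Y D ++ K)) (cost g (Y ∷ L))
  second f g {K} {L} Y D refl hx hy = inj₂
    ( ≤-trans (≤-reflexive (trans (cost-++ f (extensions (suc (suc j)) Y D) K) (+-comm _ (cost f K)))) (+-mono-≤ (base f hx)
        (cost-uniform f (extensions-size (suc (suc j)) Y D) (length-extensions (suc (suc j)) Y D)))
    , ≤-trans (≤-reflexive (+-comm (g ∣ Y ∣ᵖ) (cost g L))) (+-mono-≤ (base g hy) ≤-refl))

  shrink : ∀ {C : List (PSet n q)} → All (λ X → ∣ X ∣ᵖ < t + suc j) C → All (λ X → ∣ X ∣ᵖ ≤ t + j) C
  shrink = All.map (λ {X} h → s≤s⁻¹ (subst (∣ X ∣ᵖ <_) (+-suc t j) h))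

  join : ∀ {K K′ L C : List (PSet n q)} → Covers K K′ →
    All (λ W → Above K′ W ⊎ Above L W) C → Covers (K ++ L) C
  join {K} cov = All.map [ Any.++⁺ˡ ∘ Above-trans cov , Any.++⁺ʳ K ]′

  below : ∀ {Y} {K : List (PSet n q)} {W} → All (Y ≼_) K → Above K W → Y ≼ W
  below Y≼K W↑ with find W↑
  ... | X , X∈K , X≼W = ≼-trans (All.lookup Y≼K X∈K) X≼W

  -- Whatever lies above `K` contains `Y` and agrees with `D` in t places, while `Y` itself does
  -- not, being outside `D`. It therefore contains a further point of `D`, and the star of `Y`
  -- shrinks to a few sets of size t + 1.
  through : ∀ {Y D} {K L C : List (PSet n q)} → ∣ Y ∣ᵖ ≡ t → ∣ D ∣ᵖ ≤ t + suc j → ¬ Y ≼ D → All (Y ≼_) K →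
    All (λ W → t ≤ agr W D) C →
    All (λ W → Above K W ⊎ Above L W) C → Covers (extensions (suc (suc j)) Y D ++ L) C
  through sizeY small Y⋠D Y≼K meets cov = All.map
    (λ { (m , inj₁ p) → Any.++⁺ˡ (extend sizeY small Y⋠D (below Y≼K p) m)
       ; (m , inj₂ p) → Any.++⁺ʳ _ p }) (All.zip (meets , cov))

  star : ∀ {Y} {K L C : List (PSet n q)} → All (Y ≼_) K →
    All (λ W → Above K W ⊎ Above L W) C → Covers (Y ∷ L) C
  star Y≼K = All.map [ here ∘ below Y≼K , there ]′

  RA = branch {t = t} {suc (suc j)} (lt smallB) (suc j) (subsets-size t B₀)
  levelA = level f (All.lookup smallB B₀∈B) RA

  -- The stopped list enters as a variable so that its emptiness can be matched on. If it is empty,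
  -- the frontier covers all of `A`, while for `B` there remain only the stars of the `t`-subsets of
  -- `A₀`.
  stageA : ∀ A′ → All (Meets t B) A′ → All (λ X → ∣ X ∣ᵖ < t + suc j) A′ →
    All (λ W → Above A′ W ⊎ Above (frontier RA) W) A → Peeled t f g (suc j) A B
  stageA [] _ _ coverA = peeled (frontier RA) (subsets t A₀)
    (All.map (λ { (inj₂ p) → p }) coverA) (subsets-cover A₀∈A flipped)
    (inj₁ (first f g levelA (cost-uniform g (subsets-size t A₀) (length-subsets≤ (All.lookup smallA A₀∈A)))))
  -- `B` is grown against the new `A′`, not against `A`, so that the two new lists again agree
  -- pairwise in t places and the recursion applies to them.
  stageA A′@(A₁ ∷ A″) meetsA smallA′ coverA = stageB (stopped RB) (stopped-meets RB) (stopped-size RB)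
    (All.map (λ {T} m → above RB m (subsets-above t A₁ T (All.lookup m (here refl)))) flippedA)
    where
    flippedA = Meets-flip meetsA
    smallA″ = All.map <⇒≤ smallA′
    RB = branch {t = t} {suc (suc j)} (lt smallA″) (suc j) (subsets-size t A₁)
    levelB = level g (All.lookup smallA″ (here refl)) RB

    stageB : ∀ B′ → All (Meets t A′) B′ → All (λ X → ∣ X ∣ᵖ < t + suc j) B′ →
      All (λ W → Above B′ W ⊎ Above (frontier RB) W) B → Peeled t f g (suc j) A B
    stageB [] _ _ coverB = peeled (subsets t B₀) (frontier RB)
      (subsets-cover B₀∈B cross) (All.map (λ { (inj₂ p) → p }) coverB)
      (inj₂ (first g f levelB (cost-uniform f (subsets-size t B₀) (length-subsets≤ (All.lookup smallB B₀∈B)))))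
    stageB B′@(_ ∷ _) meetsB smallB′ coverB with trivial-or-not t A₁ A″ B′
    ... | inj₂ nontrivial′ = peeled (coverA′ ++ frontier RA) (coverB′ ++ frontier RB)
          (join coversA′ coverA) (join coversB′ coverB)
          (subst₂ (λ x y → Bounds t f g (suc j) x y ⊎ Bounds t g f (suc j) y x)
            (sym (cost-++ f coverA′ (frontier RA))) (sym (cost-++ g coverB′ (frontier RB)))
            (Sum.map (Bounds-suc t f g j levelA levelB) (Bounds-suc t g f j levelB levelA) bounds′))
      where
      open Peeled (peel {t = t} {f} {g} 1≤t j (here refl) (here refl)
        (shrink smallA′) (shrink smallB′) (Meets-flip meetsB) nontrivial′)
        renaming (coverA to coverA′; coverB to coverB′; coversA to coversA′; coversB to coversB′; bounds to bounds′)
    ... | inj₁ (Y , sizeY , Y≼A′ , Y≼B′) with all? (Y ≼?_) B | all? (Y ≼?_) A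
    ...   | yes Y≼B | yes Y≼A = ⊥-elim (nontrivial Y sizeY Y≼A Y≼B)
    ...   | no Y⋠B | _ with find (All.¬All⇒Any¬ (Y ≼?_) B Y⋠B)
    ...     | D , D∈B , Y⋠D = peeled (extensions (suc (suc j)) Y D ++ frontier RA) (Y ∷ frontier RB)
          (through sizeY (All.lookup smallB D∈B) Y⋠D Y≼A′ (All.map (λ m → All.lookup m D∈B) cross) coverA)
          (star Y≼B′ coverB)
          (inj₁ (second f g {frontier RA} {frontier RB} Y D sizeY levelA levelB))
    stageB B′ meetsB smallB′ coverB | inj₁ (Y , sizeY , Y≼A′ , Y≼B′) | yes _ | no Y⋠A
      with find (All.¬All⇒Any¬ (Y ≼?_) A Y⋠A)
    ...     | D , D∈A , Y⋠D = peeled (Y ∷ frontier RA) (extensions (suc (suc j)) Y D ++ frontier RB)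
          (star Y≼A′ coverA)
          (through sizeY (All.lookup smallA D∈A) Y⋠D Y≼B′ (All.map (λ m → All.lookup m D∈A) flipped) coverB)
          (inj₂ (second g f {frontier RB} {frontier RA} Y D sizeY levelB levelA))

  result : Peeled t f g (suc j) A B
  result = stageA (stopped RA) (stopped-meets RA) (stopped-size RA)
    (All.map (λ {W} m → above RA m (subsets-above t B₀ W (All.lookup m B₀∈B))) cross)

-- Counting supersets

-- The number of signed k-sets above a given signed s-set; the case distinction is needed
-- because truncated subtraction would give 1 instead of 0 for s > k.
weight : (n k q s : ℕ) → ℕ
weight n k q s with s ≤? k
... | yes _ = ((n ∸ s) C (k ∸ s)) * q ^ (k ∸ s)
... | no _  = 0

weight-≤ : ∀ n k q {s} → s ≤ k → weight n k q s ≡ ((n ∸ s) C (k ∸ s)) * q ^ (k ∸ s)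
weight-≤ n k q {s} s≤k with s ≤? k
... | yes _  = refl
... | no s≰k = contradiction s≤k s≰k

weight-> : ∀ n k q {s} → ¬ s ≤ k → weight n k q s ≡ 0
weight-> n k q {s} s≰k with s ≤? k
... | yes s≤k = contradiction s≤k s≰k
... | no _    = refl

weight>0 : ∀ {n k q s} .{{_ : NonZero q}} → s ≤ k → k ≤ n → 0 < weight n k q s
weight>0 {n} {k} {q} {s} s≤k k≤n = subst (0 <_) (sym (weight-≤ n k q s≤k))
  (*-mono-≤ (C>0 (∸-monoˡ-≤ s k≤n)) (m^n>0 q (k ∸ s)))

-- The exact ratio from s to s + 1 is (k-s)/(q(n-s)). Since k < n, the fraction (k-s)/(n-s)
-- decreases in s, so its value at s = t serves every level.
weight-ratio : ∀ n k q t a → k < n →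
  (n ∸ t) * q * weight n k q (t + suc a) ≤ (k ∸ t) * weight n k q (t + a)
weight-ratio n k q t a k<n with t + suc a ≤? k
... | no >k = subst (_≤ (k ∸ t) * weight n k q (t + a)) (sym (*-zeroʳ ((n ∸ t) * q))) z≤n
... | yes ≤k with m≤n⇒∃[o]m+o≡n ≤k | m≤n⇒∃[o]m+o≡n k<n
... | r , refl | d , refl = begin
  (n ∸ t) * q * (((n ∸ s) C (k ∸ s)) * q ^ (k ∸ s))
    ≡⟨ cong₂ _*_ (cong (_* q) n∸t) (cong₂ _*_ (cong₂ _C_ n∸s k∸s) (cong (q ^_) k∸s)) ⟩
  (suc a + e) * q * ((e C r) * q ^ r)
    ≤⟨ *-cancelˡ-≤ (suc r) main ⟩
  (suc a + r) * ((suc e C suc r) * q ^ suc r)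
    ≡⟨ cong₂ _*_ k∸t (trans (weight-≤ n k q (≤-trans (+-monoʳ-≤ t (n≤1+n a)) ≤k))
         (cong₂ _*_ (cong₂ _C_ n∸s′ k∸s′) (cong (q ^_) k∸s′))) ⟨
  (k ∸ t) * weight n k q (t + a) ∎
  where
  open ≤-Reasoning
  s e : ℕ
  s = t + suc a
  e = suc (r + d)
  k∸s : k ∸ s ≡ r
  k∸s = m+n∸m≡n s r
  k∸t : k ∸ t ≡ suc a + r
  k∸t = trans (cong (_∸ t) (+-assoc t (suc a) r)) (m+n∸m≡n t (suc a + r))
  n∸s : n ∸ s ≡ e
  n∸s = trans (cong (_∸ s) (eq s r d)) (m+n∸m≡n s e)
    where
    eq : ∀ s r d → suc (s + r + d) ≡ s + suc (r + d)
    eq = solve-∀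
  n∸t : n ∸ t ≡ suc a + e
  n∸t = trans (cong (_∸ t) (eq t a r d)) (m+n∸m≡n t (suc a + e))
    where
    eq : ∀ t a r d → suc (t + suc a + r + d) ≡ t + (suc a + suc (r + d))
    eq = solve-∀
  n∸s′ : n ∸ (t + a) ≡ suc e
  n∸s′ = trans (cong (_∸ (t + a)) (eq t a r d)) (m+n∸m≡n (t + a) (suc e))
    where
    eq : ∀ t a r d → suc (t + suc a + r + d) ≡ t + a + suc (suc (r + d))
    eq = solve-∀
  k∸s′ : k ∸ (t + a) ≡ suc r
  k∸s′ = trans (cong (_∸ (t + a)) (eq t a r)) (m+n∸m≡n (t + a) (suc r))
    where
    eq : ∀ t a r → t + suc a + r ≡ t + a + suc r
    eq = solve-∀
  -- The factor `suc r` clears the denominator of the absorption identity; what remains is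
  -- (r+1)(a+1+e) ≤ (a+1+r)(e+1), where r + 1 ≤ e + 1.
  main : suc r * ((suc a + e) * q * ((e C r) * q ^ r)) ≤ suc r * ((suc a + r) * ((suc e C suc r) * q ^ suc r))
  main = begin
    suc r * ((suc a + e) * q * ((e C r) * q ^ r))     ≡⟨ e₁ r a e q (e C r) (q ^ r) ⟩
    (suc r * suc e + a * suc r) * ((e C r) * (q * q ^ r))
      ≤⟨ *-monoˡ-≤ ((e C r) * (q * q ^ r)) (+-monoʳ-≤ (suc r * suc e) (*-monoʳ-≤ a (s≤s (m≤n⇒m≤1+n (m≤m+n r d))))) ⟩
    (suc r * suc e + a * suc e) * ((e C r) * (q * q ^ r)) ≡⟨ e₂ r a e q (e C r) (q ^ r) ⟩
    (suc a + r) * (suc e * (e C r) * (q * q ^ r))     ≡⟨ cong (λ z → (suc a + r) * (z * (q * q ^ r))) (C-absorption e r) ⟨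
    (suc a + r) * (suc r * (suc e C suc r) * (q * q ^ r)) ≡⟨ e₃ r (suc a + r) (suc e C suc r) (q * q ^ r) ⟩
    suc r * ((suc a + r) * ((suc e C suc r) * (q * q ^ r))) ∎
    where
    e₁ : ∀ r a e q c p → suc r * ((suc a + e) * q * (c * p)) ≡ (suc r * suc e + a * suc r) * (c * (q * p))
    e₁ = solve-∀
    e₂ : ∀ r a e q c p → (suc r * suc e + a * suc e) * (c * (q * p)) ≡ (suc a + r) * (suc e * c * (q * p))
    e₂ = solve-∀
    e₃ : ∀ r u c p → u * (suc r * c * p) ≡ suc r * (u * (c * p))
    e₃ = solve-∀

_∈?_ : (X : PSet n q) (K : List (PSet n q)) → Dec (X ∈ˡ K)
X ∈? K = any? (X ≟ᵖ_) K
  where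
  _≟ᵖ_ : (X Y : PSet n q) → Dec (X ≡ Y)
  _≟ᵖ_ = Vec.≡-dec (≡-dec _≟_)

module _ {a} {A : Set a} where

  unique-⊆⇒length≤ : ∀ {xs ys : List A} → Unique xs → (∀ {x} → x ∈ˡ xs → x ∈ˡ ys) → length xs ≤ length ys
  unique-⊆⇒length≤ [] _ = z≤n
  unique-⊆⇒length≤ {x ∷ xs} (x∉xs ∷ uxs) sub with ∈-∃++ (sub (here refl))
  ... | ys₁ , ys₂ , refl = begin
    suc (length xs)               ≤⟨ s≤s (unique-⊆⇒length≤ uxs sub′) ⟩
    suc (length (ys₁ ++ ys₂))     ≡⟨ cong suc (length-++ ys₁) ⟩
    suc (length ys₁ + length ys₂) ≡⟨ +-suc (length ys₁) (length ys₂) ⟨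
    length ys₁ + suc (length ys₂) ≡⟨ length-++ ys₁ ⟨
    length (ys₁ ++ x ∷ ys₂)       ∎
    where
    open ≤-Reasoning
    sub′ : ∀ {y} → y ∈ˡ xs → y ∈ˡ ys₁ ++ ys₂
    sub′ y∈xs with ∈-++⁻ ys₁ (sub (there y∈xs))
    ... | inj₁ p            = ∈-++⁺ˡ p
    ... | inj₂ (here refl)  = contradiction refl (All.lookup x∉xs y∈xs)
    ... | inj₂ (there p)    = ∈-++⁺ʳ ys₁ p

-- Equals n - |X|, in a form that recursion can follow without truncated subtraction.
blanks : PSet n q → ℕ
blanks []            = 0
blanks (nothing ∷ X) = suc (blanks X)
blanks (just _ ∷ X)  = blanks X

∣∣+blanks : (X : PSet n q) → ∣ X ∣ᵖ + blanks X ≡ n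
∣∣+blanks []            = refl
∣∣+blanks (nothing ∷ X) = trans (+-suc ∣ X ∣ᵖ (blanks X)) (cong suc (∣∣+blanks X))
∣∣+blanks (just _ ∷ X)  = cong suc (∣∣+blanks X)

prepend : Fin q → PSet n q → PSet (suc n) q
prepend a X = just a ∷ X

completions : ℕ → PSet n q → List (PSet n q)
completions zero    []            = [] ∷ []
completions (suc r) []            = []
completions r       (just a ∷ X)  = map (just a ∷_) (completions r X)
completions zero    (nothing ∷ X) = map (nothing ∷_) (completions zero X)
completions (suc r) (nothing ∷ X) =
  map (nothing ∷_) (completions (suc r) X) ++ cartesianProductWith prepend (allFin _) (completions r X)

length-prepend : ∀ (as : List (Fin q)) (Xs : List (PSet n q)) →
  length (cartesianProductWith prepend as Xs) ≡ length as * length Xs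
length-prepend []       Xs = refl
length-prepend (a ∷ as) Xs = trans (length-++ (map (prepend a) Xs))
  (cong₂ _+_ (length-map (prepend a) Xs) (length-prepend as Xs))

length-completions : ∀ r (X : PSet n q) → length (completions r X) ≡ (blanks X C r) * q ^ r
length-completions zero    [] = refl
length-completions {q = q} (suc r) [] = sym (cong (_* q ^ suc r) (k>n⇒nCk≡0 {0} {suc r} (s≤s z≤n)))
length-completions zero    (just a ∷ X) = trans (length-map _ (completions 0 X)) (length-completions zero X)
length-completions (suc r) (just a ∷ X) = trans (length-map _ (completions (suc r) X)) (length-completions (suc r) X)
length-completions zero    (nothing ∷ X) = trans (length-map _ (completions 0 X)) (trans (length-completions zero X)
  (cong (_* 1) (trans (nC0≡1 (blanks X)) (sym (nC0≡1 (suc (blanks X)))))))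
length-completions {q = q} (suc r) (nothing ∷ X) = begin
  length (map (nothing ∷_) (completions (suc r) X) ++ cartesianProductWith prepend (allFin q) (completions r X))
    ≡⟨ length-++ (map (nothing ∷_) (completions (suc r) X)) ⟩
  length (map (nothing ∷_) (completions (suc r) X)) + length (cartesianProductWith prepend (allFin q) (completions r X))
    ≡⟨ cong₂ _+_ (trans (length-map _ (completions (suc r) X)) (length-completions (suc r) X))
        (trans (length-prepend (allFin q) (completions r X)) (cong₂ _*_ (length-tabulate {n = q} id) (length-completions r X))) ⟩
  (blanks X C suc r) * (q * q ^ r) + q * ((blanks X C r) * q ^ r)
    ≡⟨ eq (blanks X C suc r) (blanks X C r) q (q ^ r) ⟩
  ((blanks X C r) + (blanks X C suc r)) * (q * q ^ r)
    ≡⟨ cong (_* (q * q ^ r)) (nCk+nC[k+1]≡[n+1]C[k+1] (blanks X) r) ⟩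
  (suc (blanks X) C suc r) * (q * q ^ r) ∎
  where
  open ≡-Reasoning
  eq : ∀ x y q p → x * (q * p) + q * (y * p) ≡ (y + x) * (q * p)
  eq = solve-∀

∷-injʳ : ∀ {m : Maybe (Fin q)} {X Y : PSet n q} → (m ∷ X) ≡ (m ∷ Y) → X ≡ Y
∷-injʳ refl = refl

completions-unique : ∀ r (X : PSet n q) → Unique (completions r X)
completions-unique zero    [] = [] ∷ []
completions-unique (suc r) [] = []
completions-unique zero    (just a ∷ X)  = Unique.map⁺ ∷-injʳ (completions-unique zero X)
completions-unique (suc r) (just a ∷ X)  = Unique.map⁺ ∷-injʳ (completions-unique (suc r) X)
completions-unique zero    (nothing ∷ X) = Unique.map⁺ ∷-injʳ (completions-unique zero X)
completions-unique {q = q} (suc r) (nothing ∷ X) = Unique.++⁺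
  (Unique.map⁺ ∷-injʳ (completions-unique (suc r) X))
  (Unique.cartesianProductWith⁺ prepend (λ { refl → refl , refl }) (Unique.allFin⁺ q) (completions-unique r X))
  disjoint
  where
  disjoint : ∀ {W} → W ∈ˡ map (nothing ∷_) (completions (suc r) X) × W ∈ˡ cartesianProductWith prepend (allFin q) (completions r X) → ⊥
  disjoint (p , r∈) with ∈-map⁻ _ p | ∈-cartesianProductWith⁻ prepend (allFin q) (completions r X) r∈
  ... | _ , _ , refl | _ , _ , _ , _ , ()

completions-complete : ∀ r {X W : PSet n q} → X ≼ W → ∣ W ∣ᵖ ≡ ∣ X ∣ᵖ + r → W ∈ˡ completions r X
completions-complete zero    [] e = here refl
completions-complete (suc r) [] ()
completions-complete zero    (keep a p) e = ∈-map⁺ _ (completions-complete zero p (suc-injective e))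
completions-complete (suc r) (keep a p) e = ∈-map⁺ _ (completions-complete (suc r) p (suc-injective e))
completions-complete zero    (skip nothing p) e = ∈-map⁺ _ (completions-complete zero p e)
completions-complete (suc r) (skip nothing p) e = ∈-++⁺ˡ (∈-map⁺ _ (completions-complete (suc r) p e))
completions-complete zero    {_ ∷ X} (skip (just a) p) e =
  contradiction (≼⇒∣∣≤ p) (<⇒≱ (≤-reflexive (trans e (+-identityʳ ∣ X ∣ᵖ))))
completions-complete (suc r) {_ ∷ X} (skip (just a) p) e =
  ∈-++⁺ʳ _ (∈-cartesianProductWith⁺ prepend (∈-allFin a) (completions-complete r p (suc-injective (trans e (+-suc ∣ X ∣ᵖ r)))))

completions-sound : ∀ r (X : PSet n q) → All (λ W → X ≼ W × ∣ W ∣ᵖ ≡ ∣ X ∣ᵖ + r) (completions r X)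
completions-sound zero    [] = ([] , refl) ∷ []
completions-sound (suc r) [] = []
completions-sound zero    (just a ∷ X)  = All.map⁺ (All.map (λ (p , e) → keep a p , cong suc e) (completions-sound zero X))
completions-sound (suc r) (just a ∷ X)  = All.map⁺ (All.map (λ (p , e) → keep a p , cong suc e) (completions-sound (suc r) X))
completions-sound zero    (nothing ∷ X) = All.map⁺ (All.map (λ (p , e) → skip nothing p , e) (completions-sound zero X))
completions-sound {q = q} (suc r) (nothing ∷ X) = All.++⁺
  (All.map⁺ (All.map (λ (p , e) → skip nothing p , e) (completions-sound (suc r) X)))
  (All.tabulate extended)
  where
  extended : ∀ {W} → W ∈ˡ cartesianProductWith prepend (allFin q) (completions r X) → nothing ∷ X ≼ W × ∣ W ∣ᵖ ≡ ∣ X ∣ᵖ + suc r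
  extended W∈ with ∈-cartesianProductWith⁻ prepend (allFin q) (completions r X) W∈
  ... | a , W , _ , W∈′ , refl with All.lookup (completions-sound r X) W∈′
  ... | p , e = skip (just a) p , trans (cong suc e) (sym (+-suc ∣ X ∣ᵖ r))

supersets : ℕ → PSet n q → List (PSet n q)
supersets k X with ∣ X ∣ᵖ ≤? k
... | yes _ = completions (k ∸ ∣ X ∣ᵖ) X
... | no _  = []

length-supersets : ∀ k (X : PSet n q) → length (supersets k X) ≡ weight n k q ∣ X ∣ᵖ
length-supersets {n} {q} k X with ∣ X ∣ᵖ ≤? k
... | yes _ = trans (length-completions (k ∸ ∣ X ∣ᵖ) X) (cong (λ z → (z C (k ∸ ∣ X ∣ᵖ)) * q ^ (k ∸ ∣ X ∣ᵖ)) blanks≡)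
  where
  blanks≡ : blanks X ≡ n ∸ ∣ X ∣ᵖ
  blanks≡ = trans (sym (m+n∸m≡n ∣ X ∣ᵖ (blanks X))) (cong (_∸ ∣ X ∣ᵖ) (∣∣+blanks X))
... | no _  = refl

supersets-unique : ∀ k (X : PSet n q) → Unique (supersets k X)
supersets-unique k X with ∣ X ∣ᵖ ≤? k
... | yes _ = completions-unique (k ∸ ∣ X ∣ᵖ) X
... | no _  = []

supersets-complete : ∀ {k} {X W : PSet n q} → X ≼ W → ∣ W ∣ᵖ ≡ k → W ∈ˡ supersets k X
supersets-complete {k = k} {X} p refl with ∣ X ∣ᵖ ≤? k
... | yes X≤k = completions-complete (k ∸ ∣ X ∣ᵖ) p (sym (m+[n∸m]≡n X≤k))
... | no X≰k  = contradiction (≼⇒∣∣≤ p) X≰k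

supersets-sound : ∀ k (X : PSet n q) → All (λ W → X ≼ W × ∣ W ∣ᵖ ≡ k) (supersets k X)
supersets-sound k X with ∣ X ∣ᵖ ≤? k
... | yes X≤k = All.map (λ (p , e) → p , trans e (m+[n∸m]≡n X≤k)) (completions-sound (k ∸ ∣ X ∣ᵖ) X)
... | no _    = []

-- Every member of `F` occurs in the concatenated lists of supersets of `K`. As `F` has no
-- repetitions, overlaps between these lists only weaken the bound.
length≤cost : ∀ {k} {F K : List (PSet n q)} → Unique F → All (λ W → ∣ W ∣ᵖ ≡ k) F → Covers K F →
  length F ≤ cost (weight n k q) K
length≤cost {n} {q} {k} {F} {K} unique sizes covers = ≤-trans
  (unique-⊆⇒length≤ unique (λ W∈F → inSupersets (All.lookup sizes W∈F) (All.lookup covers W∈F)))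
  (≤-reflexive (total K))
  where
  inSupersets : ∀ {K W} → ∣ W ∣ᵖ ≡ k → Above K W → W ∈ˡ concatMap (supersets k) K
  inSupersets e (here p)  = ∈-++⁺ˡ (supersets-complete p e)
  inSupersets e (there p) = ∈-++⁺ʳ _ (inSupersets e p)
  total : ∀ K → length (concatMap (supersets k) K) ≡ cost (weight n k q) K
  total []      = refl
  total (X ∷ K) = trans (length-++ (supersets k X)) (cong₂ _+_ (length-supersets k X) (total K))

star-length≤ : ∀ {k Y} {F : List (PSet n q)} → Unique F → All (λ W → ∣ W ∣ᵖ ≡ k) F → All (Y ≼_) F →
  length F ≤ weight n k q ∣ Y ∣ᵖ
star-length≤ {n} {q} {k} {Y} unique sizes above = ≤-trans
  (length≤cost {K = Y ∷ []} unique sizes (All.map here above)) (≤-reflexive (+-identityʳ (weight n k q ∣ Y ∣ᵖ)))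

-- Pigeonhole: a missing `W` could be put in front of `F`, giving a repetition-free list above `Y`
-- longer than `star-length≤` allows.
star-full : ∀ {k Y} {F : List (PSet n q)} → Unique F → All (λ W → ∣ W ∣ᵖ ≡ k) F → All (Y ≼_) F →
  length F ≡ weight n k q ∣ Y ∣ᵖ → ∀ {W} → Y ≼ W → ∣ W ∣ᵖ ≡ k → W ∈ˡ F
star-full {n} {q} {k} {Y} {F} unique sizes above full {W} Y≼W sizeW with W ∈? F
... | yes W∈F = W∈F
... | no W∉F  = contradiction
  (star-length≤ (All.¬Any⇒All¬ F W∉F ∷ unique) (sizeW ∷ sizes) (Y≼W ∷ above))
  (<⇒≱ (≤-reflexive (cong suc (sym full))))

star-length≥ : ∀ {k Y} {F : List (PSet n q)} → (∀ {W} → Y ≼ W → ∣ W ∣ᵖ ≡ k → W ∈ˡ F) →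
  weight n k q ∣ Y ∣ᵖ ≤ length F
star-length≥ {k = k} {Y} h = subst (_≤ _) (length-supersets k Y) (unique-⊆⇒length≤ (supersets-unique k Y)
  (λ W∈ → let (p , e) = All.lookup (supersets-sound k Y) W∈ in h p e))

-- Numerical estimates

-- Only e ≥ 8/3 = 1 + 1 + 1/2 + 1/6 is used.
threshold : ∀ {n t M q} .{{_ : NonZero q}} → n ≥ t +2e M / q → 16 * M ≤ 3 * (q * (n ∸ t))
threshold {n} {t} {M} {q@(suc p)} h = begin
  16 * M                              ≡⟨ m+n∸m≡n (3 * (q * t)) (16 * M) ⟨
  3 * (q * t) + 16 * M ∸ 3 * (q * t)  ≤⟨ ∸-monoˡ-≤ (3 * (q * t)) cleared ⟩
  3 * (q * n) ∸ 3 * (q * t)           ≡⟨ *-distribˡ-∸ 3 (q * n) (q * t) ⟨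
  3 * (q * n ∸ q * t)                 ≡⟨ cong (3 *_) (*-distribˡ-∸ q n t) ⟨
  3 * (q * (n ∸ t))                   ∎
  where
  open ≤-Reasoning
  -- Fractions in `ℚ` are reduced by a gcd that does not compute on variables. The comparison moves
  -- to unnormalised fractions, where only the closed sum `eSum 3` is evaluated, to 8/3.
  left : toℚᵘ ((ℤ.+ t) / 1 ℚ.+ ((ℤ.+ (2 * M)) / q) ℚ.* eSum 3)
    ℚᵘ.≃ mkℚᵘ (ℤ.+ t) 0 ℚᵘ.+ mkℚᵘ (ℤ.+ (2 * M)) p ℚᵘ.* mkℚᵘ (ℤ.+ 8) 2
  left = ℚᵘP.≃-trans (ℚP.toℚᵘ-homo-+ ((ℤ.+ t) / 1) (((ℤ.+ (2 * M)) / q) ℚ.* eSum 3))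
    (ℚᵘP.+-cong (ℚP.toℚᵘ-fromℚᵘ (mkℚᵘ (ℤ.+ t) 0))
      (ℚᵘP.≃-trans (ℚP.toℚᵘ-homo-* ((ℤ.+ (2 * M)) / q) (eSum 3))
        (ℚᵘP.*-cong (ℚP.toℚᵘ-fromℚᵘ (mkℚᵘ (ℤ.+ (2 * M)) p)) (*≡* refl))))
  unnormalised : mkℚᵘ (ℤ.+ t) 0 ℚᵘ.+ mkℚᵘ (ℤ.+ (2 * M)) p ℚᵘ.* mkℚᵘ (ℤ.+ 8) 2 ℚᵘ.≤ mkℚᵘ (ℤ.+ n) 0
  unnormalised = ℚᵘP.≤-respˡ-≃ left (ℚᵘP.≤-respʳ-≃ (ℚP.toℚᵘ-fromℚᵘ (mkℚᵘ (ℤ.+ n) 0)) (ℚP.toℚᵘ-mono-≤ (h 3)))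
  natural : (t * (q * 3) + 2 * M * 8 * 1) * 1 ≤ n * (1 * (q * 3))
  natural = ℤP.drop‿+≤+ (subst₂ ℤ._≤_ eqˡ (sym (ℤP.pos-* n (1 * (q * 3)))) (ℚᵘP.drop-*≤* unnormalised))
    where
    eqˡ : ((ℤ.+ t) ℤ.* (ℤ.+ (q * 3)) ℤ.+ (ℤ.+ (2 * M)) ℤ.* (ℤ.+ 8) ℤ.* (ℤ.+ 1)) ℤ.* (ℤ.+ 1)
      ≡ ℤ.+ ((t * (q * 3) + 2 * M * 8 * 1) * 1)
    eqˡ = trans (cong (ℤ._* (ℤ.+ 1)) (cong₂ ℤ._+_ (sym (ℤP.pos-* t (q * 3)))
        (trans (cong (ℤ._* (ℤ.+ 1)) (sym (ℤP.pos-* (2 * M) 8))) (sym (ℤP.pos-* (2 * M * 8) 1)))))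
      (sym (ℤP.pos-* (t * (q * 3) + 2 * M * 8 * 1) 1))
  cleared : 3 * (q * t) + 16 * M ≤ 3 * (q * n)
  cleared = subst₂ _≤_ (e₁ q t M) (e₂ q n) natural
    where
    e₁ : ∀ q t M → (t * (q * 3) + 2 * M * 8 * 1) * 1 ≡ 3 * (q * t) + 16 * M
    e₁ = solve-∀
    e₂ : ∀ q n → n * (1 * (q * 3)) ≡ 3 * (q * n)
    e₂ = solve-∀

ratio-scaled : ∀ m {N q w w′ K} → N * q * w′ ≤ m * w → 16 * K ≤ 3 * (q * N) → 16 * (K * w′) ≤ 3 * (m * w)
ratio-scaled m {N} {q} {w} {w′} {K} ratio h = begin
  16 * (K * w′)        ≡⟨ *-assoc 16 K w′ ⟨
  16 * K * w′          ≤⟨ *-monoˡ-≤ w′ h ⟩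
  3 * (q * N) * w′     ≡⟨ eq q N w′ ⟩
  3 * (N * q * w′)     ≤⟨ *-monoʳ-≤ 3 ratio ⟩
  3 * (m * w)          ∎
  where
  open ≤-Reasoning
  eq : ∀ q N w′ → 3 * (q * N) * w′ ≡ 3 * (N * q * w′)
  eq = solve-∀

-- For m = k - t positive, m cancels between the ratio and the threshold. For m = 0 the threshold
-- says nothing, but the ratio itself then forces `w′` to vanish.
ratio-cancelled : ∀ m {N q w w′ K} → N * q * w′ ≤ m * w → 0 < N → 0 < q →
  16 * (K * m) ≤ 3 * (q * N) → 16 * (K * w′) ≤ 3 * w
ratio-cancelled zero {N} {q} {w} {w′} {K} ratio N>0 q>0 _ =
  subst (λ z → 16 * (K * z) ≤ 3 * w) (sym w′≡0) (subst (λ z → 16 * z ≤ 3 * w) (sym (*-zeroʳ K)) z≤n)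
  where
  w′≡0 : w′ ≡ 0
  w′≡0 = n≤0⇒n≡0 (≤-trans (≤-reflexive (sym (*-identityˡ w′))) (≤-trans (*-monoˡ-≤ w′ {1} {N * q} (*-mono-≤ N>0 q>0)) ratio))
ratio-cancelled m@(suc _) {N} {q} {w} {w′} {K} ratio _ _ h = *-cancelˡ-≤ m (begin
  m * (16 * (K * w′))   ≡⟨ e₁ m K w′ ⟩
  16 * (K * m * w′)     ≤⟨ ratio-scaled m {N} {q} {w} {w′} {K * m} ratio h ⟩
  3 * (m * w)           ≡⟨ e₂ m w ⟩
  m * (3 * w)           ∎)
  where
  open ≤-Reasoning
  e₁ : ∀ m K x → m * (16 * (K * x)) ≡ 16 * (K * m * x)
  e₁ = solve-∀
  e₂ : ∀ m y → 3 * (m * y) ≡ m * (3 * y)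
  e₂ = solve-∀

module _ {t : ℕ} (f : ℕ → ℕ) where

  levelTerm-0 : levelTerm t (f ∘ (t +_)) 0 ≡ f t
  levelTerm-0 rewrite +-identityʳ t | nCn≡1 t = *-identityˡ (f t)

  productTerm-0 : productTerm t (f ∘ (t +_)) 0 ≡ f t
  productTerm-0 = trans (cong (((t + 0) C t) *_) levelTerm-0)
    (trans (cong (_* f t) (trans (cong (_C t) (+-identityʳ t)) (nCn≡1 t))) (*-identityˡ (f t)))

  levelSum-bound : (∀ a → 16 * ((t + suc a) * f (t + suc a)) ≤ 3 * f (t + a)) → ∀ j → 4 * levelSum t f j ≤ 3 * f t
  levelSum-bound h j = subst (λ z → 4 * levelSum t f j ≤ 3 * z) levelTerm-0
    (Σ₁-decays (levelTerm-decays t (f ∘ (t +_)) h) j)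

  productSum-bound : (∀ a → 16 * ((t + suc a) ^ 2 * f (t + suc a)) ≤ 3 * (suc a * f (t + a))) →
    ∀ j → 4 * productSum t f j ≤ 3 * f t
  productSum-bound h j = subst (λ z → 4 * productSum t f j ≤ 3 * z) productTerm-0
    (Σ₁-decays (productTerm-decays t (f ∘ (t +_)) h) j)

  2levelSum≤productSum : 1 ≤ t → ∀ j → 2 * levelSum t f j ≤ productSum t f j
  2levelSum≤productSum 1≤t j = subst (_≤ productSum t f j) (Σ₁-*ˡ 2 (levelTerm t (f ∘ (t +_))) j)
    (Σ₁-mono₊ (2levelTerm≤productTerm t (f ∘ (t +_)) 1≤t) j)

module _ {t : ℕ} {f g : ℕ → ℕ} {j x y : ℕ} where

  open ≤-Reasoning

  -- In both alternatives `x` is at most the level sum plus the sets of size t + 1, that is at most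
  -- 3/4 + 3/16 = 15/16 of a star.
  Bounds⇒< : 0 < f t → 4 * levelSum t f j ≤ 3 * f t → 16 * (suc j * f (suc t)) ≤ 3 * f t →
    Bounds t f g j x y → x < f t
  Bounds⇒< f>0 hL hS bounds = *-cancelˡ-< 16 x (f t) (begin-strict
    16 * x                                               ≤⟨ *-monoʳ-≤ 16 (x≤ bounds) ⟩
    16 * (levelSum t f j + suc j * f (suc t))            ≡⟨ e₁ (levelSum t f j) (suc j * f (suc t)) ⟩
    4 * (4 * levelSum t f j) + 16 * (suc j * f (suc t))  ≤⟨ +-mono-≤ (*-monoʳ-≤ 4 hL) hS ⟩
    4 * (3 * f t) + 3 * f t                              ≡⟨ e₂ (f t) ⟩
    15 * f t                                             <⟨ *-monoˡ-< (f t) {{>-nonZero f>0}} (n<1+n 15) ⟩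
    16 * f t                                             ∎)
    where
    x≤ : Bounds t f g j x y → x ≤ levelSum t f j + suc j * f (suc t)
    x≤ (inj₁ (_ , _ , h , _)) = ≤-trans h (m≤m+n _ _)
    x≤ (inj₂ (h , _))         = h
    e₁ : ∀ l s → 16 * (l + s) ≡ 4 * (4 * l) + 16 * s
    e₁ = solve-∀
    e₂ : ∀ y → 4 * (3 * y) + 3 * y ≡ 15 * y
    e₂ = solve-∀

  -- Relative to the product of two stars, the alternatives give (3/8)² + 3/4 = 57/64 and (3/8 +
  -- 3/16)(3/8 + 1) = 99/128. With level sums of 3/4 instead of 3/8 both would exceed 1.
  Bounds⇒*< : 0 < f t → 0 < g t → 8 * levelSum t f j ≤ 3 * f t → 8 * levelSum t g j ≤ 3 * g t →
    4 * productSum t f j ≤ 3 * f t → 16 * (suc j * f (suc t)) ≤ 3 * f t →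
    Bounds t f g j x y → x * y < f t * g t
  Bounds⇒*< f>0 g>0 hLf hLg hQ _ (inj₁ (c , _ , x≤ , cx≤ , y≤)) = *-cancelˡ-< 64 (x * y) (f t * g t) (begin-strict
    64 * (x * y)                                         ≤⟨ *-monoʳ-≤ 64 (*-monoʳ-≤ x y≤) ⟩
    64 * (x * (levelSum t g j + c * g t))                ≡⟨ e₁ x (levelSum t g j) c (g t) ⟩
    8 * x * (8 * levelSum t g j) + 16 * (4 * (c * x)) * g t
      ≤⟨ +-mono-≤ (*-mono-≤ (≤-trans (*-monoʳ-≤ 8 x≤) hLf) hLg)
           (*-monoˡ-≤ (g t) (*-monoʳ-≤ 16 (≤-trans (*-monoʳ-≤ 4 cx≤) hQ))) ⟩
    3 * f t * (3 * g t) + 16 * (3 * f t) * g t           ≡⟨ e₂ (f t) (g t) ⟩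
    57 * (f t * g t)                                     <⟨ *-monoˡ-< (f t * g t) {{>-nonZero (*-mono-≤ f>0 g>0)}} (m≤m+n 58 6) ⟩
    64 * (f t * g t)                                     ∎)
    where
    e₁ : ∀ x l c g → 64 * (x * (l + c * g)) ≡ 8 * x * (8 * l) + 16 * (4 * (c * x)) * g
    e₁ = solve-∀
    e₂ : ∀ f g → 3 * f * (3 * g) + 16 * (3 * f) * g ≡ 57 * (f * g)
    e₂ = solve-∀
  Bounds⇒*< f>0 g>0 hLf hLg _ hS (inj₂ (x≤ , y≤)) = *-cancelˡ-< 128 (x * y) (f t * g t) (begin-strict
    128 * (x * y)               ≡⟨ e₁ x y ⟩
    16 * x * (8 * y)            ≤⟨ *-mono-≤ x-bound y-bound ⟩
    9 * f t * (11 * g t)        ≡⟨ e₂ (f t) (g t) ⟩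
    99 * (f t * g t)            <⟨ *-monoˡ-< (f t * g t) {{>-nonZero (*-mono-≤ f>0 g>0)}} (m≤m+n 100 28) ⟩
    128 * (f t * g t)           ∎)
    where
    e₁ : ∀ x y → 128 * (x * y) ≡ 16 * x * (8 * y)
    e₁ = solve-∀
    e₂ : ∀ f g → 9 * f * (11 * g) ≡ 99 * (f * g)
    e₂ = solve-∀
    e₃ : ∀ l s → 16 * (l + s) ≡ 2 * (8 * l) + 16 * s
    e₃ = solve-∀
    e₄ : ∀ f → 2 * (3 * f) + 3 * f ≡ 9 * f
    e₄ = solve-∀
    e₅ : ∀ l g → 8 * (l + g) ≡ 8 * l + 8 * g
    e₅ = solve-∀
    e₆ : ∀ g → 3 * g + 8 * g ≡ 11 * g
    e₆ = solve-∀
    x-bound : 16 * x ≤ 9 * f t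
    x-bound = begin
      16 * x                                              ≤⟨ *-monoʳ-≤ 16 x≤ ⟩
      16 * (levelSum t f j + suc j * f (suc t))           ≡⟨ e₃ (levelSum t f j) (suc j * f (suc t)) ⟩
      2 * (8 * levelSum t f j) + 16 * (suc j * f (suc t)) ≤⟨ +-mono-≤ (*-monoʳ-≤ 2 hLf) hS ⟩
      2 * (3 * f t) + 3 * f t                             ≡⟨ e₄ (f t) ⟩
      9 * f t                                             ∎
    y-bound : 8 * y ≤ 11 * g t
    y-bound = begin
      8 * y                          ≤⟨ *-monoʳ-≤ 8 y≤ ⟩
      8 * (levelSum t g j + g t)     ≡⟨ e₅ (levelSum t g j) (g t) ⟩
      8 * levelSum t g j + 8 * g t   ≤⟨ +-monoˡ-≤ (8 * g t) hLg ⟩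
      3 * g t + 8 * g t              ≡⟨ e₆ (g t) ⟩
      11 * g t                       ∎

-- Signed sets as partial functions

table : (A : Subset n) → Signing q A → PSet n q
table []            []       = []
table (inside ∷ A)  (a ∷ f)  = just a ∷ table A f
table (outside ∷ A) (tt ∷ f) = nothing ∷ table A f

table-surjective : (W : PSet n q) → Σ (Subset n) λ A → Σ (Signing q A) λ f → table A f ≡ W
table-surjective [] = [] , [] , refl
table-surjective (nothing ∷ W) with table-surjective W
... | A , f , refl = outside ∷ A , tt ∷ f , refl
table-surjective (just a ∷ W) with table-surjective W
... | A , f , refl = inside ∷ A , a ∷ f , refl

-- The conclusion is an equality of pairs because `f` and `g` have different types until the
-- supports are identified.
table-injective : ∀ (A B : Subset n) (f : Signing q A) (g : Signing q B) →
  table A f ≡ table B g → _≡_ {A = Σ (Subset n) (Signing q)} (A , f) (B , g)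
table-injective [] [] [] [] _ = refl
table-injective (inside ∷ A) (inside ∷ B) (a ∷ f) (b ∷ g) e
  with table-injective A B f g (cong Vec.tail e) | cong Vec.head e
... | refl | refl = refl
table-injective (outside ∷ A) (outside ∷ B) (tt ∷ f) (tt ∷ g) e
  with table-injective A B f g (cong Vec.tail e)
... | refl = refl
table-injective (inside ∷ A) (outside ∷ B) (a ∷ f) (tt ∷ g) ()
table-injective (outside ∷ A) (inside ∷ B) (tt ∷ f) (b ∷ g) ()

∣table∣ : (A : Subset n) (f : Signing q A) → ∣ table A f ∣ᵖ ≡ ∣ A ∣
∣table∣ []            []       = refl
∣table∣ (inside ∷ A)  (a ∷ f)  = cong suc (∣table∣ A f)
∣table∣ (outside ∷ A) (tt ∷ f) = ∣table∣ A f

encode : SignedSet n k q → PSet n q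
encode S = table (support S) (sign S)

encode-injective : {S T : SignedSet n k q} → encode S ≡ encode T → S ≡ T
encode-injective {S = signedSet A e f} {signedSet B e′ g} h with table-injective A B f g h
... | refl = cong (λ z → signedSet A z f) (≡-irrelevant e e′)

∣encode∣ : (S : SignedSet n k q) → ∣ encode S ∣ᵖ ≡ k
∣encode∣ S = trans (∣table∣ (support S) (sign S)) (size S)

encode-surjective : (W : PSet n q) → ∣ W ∣ᵖ ≡ k → Σ (SignedSet n k q) λ S → encode S ≡ W
encode-surjective W e with table-surjective W
... | A , f , refl = signedSet A (trans (sym (∣table∣ A f)) e) f , refl

agree⇒≤agr : (A B D : Subset n) (f : Signing q A) (g : Signing q B) →
  (∀ x → x ∈ D → AgreeAt f g x) → ∣ D ∣ ≤ agr (table A f) (table B g)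
agree⇒≤agr [] [] [] [] [] h = z≤n
agree⇒≤agr (s ∷ A) (r ∷ B) (outside ∷ D) (a ∷ f) (b ∷ g) h =
  ≤-trans (agree⇒≤agr A B D f g tail-agree) (agr-tail s r a b)
  where
  tail-agree : ∀ x → x ∈ D → AgreeAt f g x
  tail-agree x x∈D with h (suc x) (there x∈D)
  ... | there p , there r , e = p , r , e
  agr-tail : ∀ s r a b → agr (table A f) (table B g) ≤ agr (table (s ∷ A) (a ∷ f)) (table (r ∷ B) (b ∷ g))
  agr-tail outside outside a b = ≤-refl
  agr-tail outside inside a b = ≤-refl
  agr-tail inside outside a b = ≤-refl
  agr-tail inside inside a b with a ≟ b
  ... | yes _ = n≤1+n _
  ... | no _  = ≤-refl
agree⇒≤agr (s ∷ A) (r ∷ B) (inside ∷ D) (a ∷ f) (b ∷ g) h with h zero here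
... | here , here , refl with a ≟ a
... | no a≢a = contradiction refl a≢a
... | yes _  = s≤s (agree⇒≤agr A B D f g tail-agree)
  where
  tail-agree : ∀ x → x ∈ D → AgreeAt f g x
  tail-agree x x∈D with h (suc x) (there x∈D)
  ... | there p , there r , e = p , r , e

table-≼⁺ : (X A : Subset n) (f₀ : Signing q X) (f : Signing q A) →
  (∀ {x} (p : x ∈ X) → Σ (x ∈ A) λ r → f ⟨ r ⟩ ≡ f₀ ⟨ p ⟩) → table X f₀ ≼ table A f
table-≼⁺ [] [] [] [] _ = []
table-≼⁺ (s ∷ X) (r ∷ A) (b ∷ f₀) (a ∷ f) h = cons s r b a h (table-≼⁺ X A f₀ f tail-extends)
  where
  tail-extends : ∀ {x} (p : x ∈ X) → Σ (x ∈ A) λ r → f ⟨ r ⟩ ≡ f₀ ⟨ p ⟩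
  tail-extends p with h (there p)
  ... | there r , e = r , e
  cons : ∀ s r b a → (∀ {x} (p : x ∈ s ∷ X) → Σ (x ∈ r ∷ A) λ r → (a ∷ f) ⟨ r ⟩ ≡ (b ∷ f₀) ⟨ p ⟩) →
    table X f₀ ≼ table A f → table (s ∷ X) (b ∷ f₀) ≼ table (r ∷ A) (a ∷ f)
  cons outside outside tt tt _ p = skip _ p
  cons outside inside  tt _  _ p = skip _ p
  cons inside  r       b  a  h p with h here
  ... | here , refl = keep b p

table-≼⁻ : (X A : Subset n) (f₀ : Signing q X) (f : Signing q A) → table X f₀ ≼ table A f →
  ∀ {x} (p : x ∈ X) → Σ (x ∈ A) λ r → f ⟨ r ⟩ ≡ f₀ ⟨ p ⟩
table-≼⁻ (inside ∷ X) (inside ∷ A) (b ∷ f₀) (b ∷ f) (keep b _) here = here , refl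
table-≼⁻ (inside ∷ X) (inside ∷ A) (b ∷ f₀) (b ∷ f) (keep b h) (there p) with table-≼⁻ X A f₀ f h p
... | r , e = there r , e
table-≼⁻ (outside ∷ X) (inside ∷ A) (tt ∷ f₀) (a ∷ f) (skip _ h) (there p) with table-≼⁻ X A f₀ f h p
... | r , e = there r , e
table-≼⁻ (outside ∷ X) (outside ∷ A) (tt ∷ f₀) (tt ∷ f) (skip _ h) (there p) with table-≼⁻ X A f₀ f h p
... | r , e = there r , e

extends⇔≼ : ∀ (X : Subset n) (f₀ : Signing q X) (S : SignedSet n k q) → Extends X f₀ S ⇔ table X f₀ ≼ encode S
extends⇔≼ X f₀ S = mk⇔
  (λ (X⊆A , e) → table-≼⁺ X (support S) f₀ (sign S) (λ {x} p → X⊆A p , e x p))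
  (λ h → (λ {x} p → proj₁ (table-≼⁻ X (support S) f₀ (sign S) h {x} p))
       , (λ _ p → proj₂ (table-≼⁻ X (support S) f₀ (sign S) h p)))

tables : Family n k q → List (PSet n q)
tables F = map encode (members F)

module _ (F : Family n k q) where

  tables-unique : Unique (tables F)
  tables-unique = Unique.map⁺ encode-injective (unique F)

  tables-size : All (λ W → ∣ W ∣ᵖ ≡ k) (tables F)
  tables-size = All.map⁺ (All.tabulate λ {S} _ → ∣encode∣ S)

  card≡ : length (tables F) ≡ card F
  card≡ = length-map encode (members F)

  ∈-tables⁻ : ∀ {S} → encode S ∈ˡ tables F → S ∈ᶠ F
  ∈-tables⁻ h with ∈-map⁻ encode h
  ... | T , T∈F , e = subst (_∈ᶠ F) (sym (encode-injective e)) T∈F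

  star⇒card : ∀ {X f₀} → IsStar X f₀ F → card F ≡ weight n k q ∣ X ∣
  star⇒card {X} {f₀} star = subst₂ (λ c s → c ≡ weight n k q s) card≡ (∣table∣ X f₀) (≤-antisym
    (star-length≤ tables-unique tables-size (All.map⁺ (All.tabulate λ {S} S∈F →
      Equivalence.to (extends⇔≼ X f₀ S) (Equivalence.to (star S) S∈F))))
    (star-length≥ λ {W} X≼W e → let (S , eq) = encode-surjective W e in
      subst (_∈ˡ tables F) eq (∈-map⁺ encode (Equivalence.from (star S)
        (Equivalence.from (extends⇔≼ X f₀ S) (subst (table X f₀ ≼_) (sym eq) X≼W))))))

  module _ {X : Subset n} {f₀ : Signing q X} (above : All (table X f₀ ≼_) (tables F)) where

    card≤ : card F ≤ weight n k q ∣ X ∣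
    card≤ = subst₂ (λ c s → c ≤ weight n k q s) card≡ (∣table∣ X f₀) (star-length≤ tables-unique tables-size above)

    card⇒star : card F ≡ weight n k q ∣ X ∣ → IsStar X f₀ F
    card⇒star e S = mk⇔
      (λ S∈F → Equivalence.from (extends⇔≼ X f₀ S) (All.lookup above (∈-map⁺ encode S∈F)))
      (λ ext → ∈-tables⁻ (star-full tables-unique tables-size above
        (trans card≡ (trans e (cong (weight n k q) (sym (∣table∣ X f₀)))))
        (Equivalence.to (extends⇔≼ X f₀ S) ext) (∣encode∣ S)))

cross⇒meets : ∀ {t} (F : Family n k q) (G : Family n ℓ q) → CrossIntersecting t F G → All (Meets t (tables G)) (tables F)
cross⇒meets {t = t} F G cross = All.map⁺ (All.tabulate λ {S} S∈F → All.map⁺ (All.tabulate λ {T} T∈G →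
  let (D , _ , t≤ , agree) = cross S T S∈F T∈G in
  ≤-trans t≤ (agree⇒≤agr (support S) (support T) D (sign S) (sign T) agree)))

-- The dichotomy between a common `t`-set and a strict bound

Core : ℕ → Family n k q → Family n ℓ q → Set
Core {n} {q = q} t F G = Σ (Subset n) λ X → ∣ X ∣ ≡ t × Σ (Signing q X) λ f₀ →
  All (table X f₀ ≼_) (tables F) × All (table X f₀ ≼_) (tables G)

-- Empty lists are split off first, since the search for a common `t`-set and the peeling both start
-- from chosen members.
trivial-or-peeled : ∀ {t j f g} → 1 ≤ t → (A B : List (PSet n q)) →
  All (λ X → ∣ X ∣ᵖ ≤ t + j) A → All (λ X → ∣ X ∣ᵖ ≤ t + j) B → All (Meets t B) A →
  Trivial t A B ⊎ length A ≡ 0 ⊎ length B ≡ 0 ⊎ Peeled t f g j A B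
trivial-or-peeled 1≤t [] B _ _ _ = inj₂ (inj₁ refl)
trivial-or-peeled 1≤t (_ ∷ _) [] _ _ _ = inj₂ (inj₂ (inj₁ refl))
trivial-or-peeled {t = t} {j} 1≤t (A₀ ∷ As) B@(_ ∷ _) smallA smallB meets with trivial-or-not t A₀ As B
... | inj₁ trivial    = inj₁ trivial
... | inj₂ nontrivial = inj₂ (inj₂ (inj₂ (peel 1≤t j (here refl) (here refl) smallA smallB meets nontrivial)))

core-or-bounds : ∀ {t} → 1 ≤ t → t ≤ k → ℓ ≤ k → (F : Family n k q) (G : Family n ℓ q) → CrossIntersecting t F G →
  Core t F G ⊎ card F ≡ 0 ⊎ card G ≡ 0 ⊎
  ∃₂ λ x y → card F ≤ x × card G ≤ y ×
    (Bounds t (weight n k q) (weight n ℓ q) (k ∸ t) x y ⊎ Bounds t (weight n ℓ q) (weight n k q) (k ∸ t) y x)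
core-or-bounds {k = k} {ℓ} {n} {q} {t} 1≤t t≤k ℓ≤k F G cross
  with trivial-or-peeled {t = t} {k ∸ t} {weight n k q} {weight n ℓ q} 1≤t (tables F) (tables G)
    (All.map (λ e → ≤-reflexive (trans e (sym (m+[n∸m]≡n t≤k)))) (tables-size F))
    (All.map (λ e → ≤-trans (≤-reflexive e) (≤-trans ℓ≤k (≤-reflexive (sym (m+[n∸m]≡n t≤k))))) (tables-size G))
    (cross⇒meets F G cross)
... | inj₂ (inj₁ F≡0) = inj₂ (inj₁ (trans (sym (card≡ F)) F≡0))
... | inj₂ (inj₂ (inj₁ G≡0)) = inj₂ (inj₂ (inj₁ (trans (sym (card≡ G)) G≡0)))
... | inj₂ (inj₂ (inj₂ (peeled K L coversF coversG bounds))) = inj₂ (inj₂ (inj₂ (_ , _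
  , subst (_≤ cost (weight n k q) K) (card≡ F) (length≤cost (tables-unique F) (tables-size F) coversF)
  , subst (_≤ cost (weight n ℓ q) L) (card≡ G) (length≤cost (tables-unique G) (tables-size G) coversG)
  , bounds)))
... | inj₁ (Y , sizeY , Y≼F , Y≼G) with table-surjective Y
... | X , f₀ , refl = inj₁ (X , trans (sym (∣table∣ X f₀)) sizeY , f₀ , Y≼F , Y≼G)

-- Used with `l` equal to k and to ℓ. The ratio for `l` is weakened to the one with k - t, so that a
-- threshold stated in k alone serves both families.
module Spread {n k t q : ℕ} .{{q≢0 : NonZero q}} (k<n : k < n) (1≤t : 1 ≤ t) (t≤k : t ≤ k) {l : ℕ} (l≤k : l ≤ k) where

  private
    f : ℕ → ℕ
    f = weight n l q

    ratio : ∀ a → (n ∸ t) * q * f (t + suc a) ≤ (k ∸ t) * f (t + a)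
    ratio a = ≤-trans (weight-ratio n l q t a (≤-<-trans l≤k k<n)) (*-monoˡ-≤ (f (t + a)) (∸-monoˡ-≤ t l≤k))

    n∸t>0 : 0 < n ∸ t
    n∸t>0 = m<n⇒0<n∸m (≤-<-trans t≤k k<n)

    -- Beyond size `l` the weight is 0, so t + a + 1 may be assumed at most `l`, hence at most k.
    -- This replaces the growing factor t + a + 1 by k and keeps a + 1 within the range of
    -- `square-bound`.
    vanishing : ∀ a {c d} → (t + suc a ≤ l → 16 * (c * f (t + suc a)) ≤ d) → 16 * (c * f (t + suc a)) ≤ d
    vanishing a {c} {d} h = split (t + suc a ≤? l)
      where
      split : Dec (t + suc a ≤ l) → 16 * (c * f (t + suc a)) ≤ d
      split (yes ≤l) = h ≤l
      split (no ≰l)  = subst (_≤ d) (sym (trans (cong (λ z → 16 * (c * z)) (weight-> n l q ≰l)) (cong (16 *_) (*-zeroʳ c)))) z≤n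

    spread : ∀ {K} → 16 * (K * (k ∸ t)) ≤ 3 * (q * (n ∸ t)) → ∀ a → 16 * (K * f (t + suc a)) ≤ 3 * f (t + a)
    spread {K} h a = ratio-cancelled (k ∸ t) {n ∸ t} {q} {f (t + a)} {f (t + suc a)} {K} (ratio a) n∸t>0 (>-nonZero⁻¹ q) h

  module _ (h : 16 * (k * (k ∸ t)) ≤ 3 * (q * (n ∸ t))) where

    levelSum-small : ∀ j → 4 * levelSum t f j ≤ 3 * f t
    levelSum-small = levelSum-bound {t} f λ a → vanishing a {t + suc a} λ ≤l → ≤-trans
      (*-monoʳ-≤ 16 (*-monoˡ-≤ (f (t + suc a)) (≤-trans ≤l l≤k))) (spread {k} h a)

    -- There are k - t + 1 extensions, at most k because t is at least 1, so the threshold for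
    -- k(k-t) suffices.
    next-small : 16 * (suc (k ∸ t) * f (suc t)) ≤ 3 * f t
    next-small = begin
      16 * (suc (k ∸ t) * f (suc t))  ≤⟨ *-monoʳ-≤ 16 (*-monoˡ-≤ (f (suc t)) (≤-trans (+-monoˡ-≤ (k ∸ t) 1≤t) (≤-reflexive (m+[n∸m]≡n t≤k)))) ⟩
      16 * (k * f (suc t))            ≡⟨ cong (λ z → 16 * (k * f z)) (+-comm 1 t) ⟩
      16 * (k * f (t + 1))            ≤⟨ spread {k} h 0 ⟩
      3 * f (t + 0)                   ≡⟨ cong (λ z → 3 * f z) (+-identityʳ t) ⟩
      3 * f t                         ∎
      where open ≤-Reasoning

  module _ (h₂ : 16 * ((t + 2) ^ 2 * (k ∸ t)) ≤ 3 * (q * (n ∸ t))) (hₖ : 16 * k ^ 2 ≤ 3 * (q * (n ∸ t))) where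

    -- `h₂` is the condition at the lower end of `square-bound`. At the upper end b = k - t one has
    -- t + b = k and the factor k - t cancels, which leaves `hₖ`.
    productSum-small : ∀ j → 4 * productSum t f j ≤ 3 * f t
    productSum-small = productSum-bound {t} f λ a → vanishing a {(t + suc a) ^ 2} λ ≤l →
      square-bound t (k ∸ t) (suc a) {f (t + suc a)} {f (t + a)}
        (m+n≤o⇒m≤o∸n (suc a) (subst (_≤ k) (+-comm t (suc a)) (≤-trans ≤l l≤k))) (s≤s z≤n)
        (spread {(t + 2) ^ 2} h₂ a)
        (subst (λ z → 16 * (z ^ 2 * f (t + suc a)) ≤ 3 * ((k ∸ t) * f (t + a))) (sym (m+[n∸m]≡n t≤k))
          (ratio-scaled (k ∸ t) {n ∸ t} {q} {f (t + a)} {f (t + suc a)} {k ^ 2} (ratio a) hₖ))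

    levelSum-half : ∀ j → 8 * levelSum t f j ≤ 3 * f t
    levelSum-half j = begin
      8 * levelSum t f j        ≡⟨ *-assoc 4 2 (levelSum t f j) ⟩
      4 * (2 * levelSum t f j)  ≤⟨ *-monoʳ-≤ 4 (2levelSum≤productSum {t} f 1≤t j) ⟩
      4 * productSum t f j      ≤⟨ productSum-small j ⟩
      3 * f t                   ∎
      where open ≤-Reasoning

core-or-< : ∀ {n k t q} .{{_ : NonZero q}} → k < n → t ≤ k → 1 ≤ t → n ≥ t +2e ((k ∸ t) * k) / q →
  (F : Family n k q) → Intersecting t F → Core t F F ⊎ card F < weight n k q t
core-or-< {n} {k} {t} {q} k<n t≤k 1≤t h F int = conclude (core-or-bounds 1≤t t≤k ≤-refl F F int)
  where
  open Spread k<n 1≤t t≤k {k} ≤-refl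
  small : 16 * (k * (k ∸ t)) ≤ 3 * (q * (n ∸ t))
  small = subst (λ z → 16 * z ≤ 3 * (q * (n ∸ t))) (*-comm (k ∸ t) k) (threshold {n} {t} {(k ∸ t) * k} {q} h)
  positive : 0 < weight n k q t
  positive = weight>0 t≤k (<⇒≤ k<n)
  bounded : ∀ {x y} → Bounds t (weight n k q) (weight n k q) (k ∸ t) x y → x < weight n k q t
  bounded {x} {y} = Bounds⇒< {t} {weight n k q} {weight n k q} {k ∸ t} {x} {y} positive (levelSum-small small (k ∸ t)) (next-small small)
  conclude : _ → Core t F F ⊎ card F < weight n k q t
  conclude (inj₁ core) = inj₁ core
  conclude (inj₂ (inj₁ F≡0)) = inj₂ (subst (_< weight n k q t) (sym F≡0) positive)
  conclude (inj₂ (inj₂ (inj₁ F≡0))) = inj₂ (subst (_< weight n k q t) (sym F≡0) positive)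
  conclude (inj₂ (inj₂ (inj₂ (x , y , F≤x , _ , inj₁ b)))) = inj₂ (≤-<-trans F≤x (bounded b))
  -- Both sides of the peeling are `F`, so whichever side turns out small bounds `card F`.
  conclude (inj₂ (inj₂ (inj₂ (x , y , _ , F≤y , inj₂ b)))) = inj₂ (≤-<-trans F≤y (bounded b))

core-or-*< : ∀ {n k ℓ t q} .{{_ : NonZero q}} → k < n → ℓ ≤ k → t ≤ ℓ → 1 ≤ t →
  n ≥ t +2e (((t + 2) ^ 2 * (k ∸ t)) ⊔ (k ^ 2)) / q →
  (F : Family n k q) (G : Family n ℓ q) → CrossIntersecting t F G →
  Core t F G ⊎ card F * card G < weight n k q t * weight n ℓ q t
core-or-*< {n} {k} {ℓ} {t} {q} k<n ℓ≤k t≤ℓ 1≤t h F G cross = conclude (core-or-bounds 1≤t t≤k ℓ≤k F G cross)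
  where
  t≤k = ≤-trans t≤ℓ ℓ≤k
  module SF = Spread {n} {k} {t} {q} k<n 1≤t t≤k {k} ≤-refl
  module SG = Spread {n} {k} {t} {q} k<n 1≤t t≤k {ℓ} ℓ≤k
  M : ℕ
  M = ((t + 2) ^ 2 * (k ∸ t)) ⊔ (k ^ 2)
  h₂ : 16 * ((t + 2) ^ 2 * (k ∸ t)) ≤ 3 * (q * (n ∸ t))
  h₂ = ≤-trans (*-monoʳ-≤ 16 (m≤m⊔n ((t + 2) ^ 2 * (k ∸ t)) (k ^ 2))) (threshold {n} {t} {M} {q} h)
  hₖ : 16 * k ^ 2 ≤ 3 * (q * (n ∸ t))
  hₖ = ≤-trans (*-monoʳ-≤ 16 (m≤n⊔m ((t + 2) ^ 2 * (k ∸ t)) (k ^ 2))) (threshold {n} {t} {M} {q} h)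
  h₁ : 16 * (k * (k ∸ t)) ≤ 3 * (q * (n ∸ t))
  h₁ = ≤-trans (*-monoʳ-≤ 16 (*-monoʳ-≤ k (≤-trans (m∸n≤m k t) (≤-reflexive (sym (*-identityʳ k)))))) hₖ
  f g : ℕ → ℕ
  f = weight n k q
  g = weight n ℓ q
  f>0 : 0 < f t
  f>0 = weight>0 t≤k (<⇒≤ k<n)
  g>0 : 0 < g t
  g>0 = weight>0 t≤ℓ (≤-trans ℓ≤k (<⇒≤ k<n))
  j = k ∸ t
  conclude : _ → Core t F G ⊎ card F * card G < f t * g t
  conclude (inj₁ core) = inj₁ core
  conclude (inj₂ (inj₁ F≡0)) = inj₂ (subst (λ z → z * card G < f t * g t) (sym F≡0) (*-mono-≤ f>0 g>0))
  conclude (inj₂ (inj₂ (inj₁ G≡0))) = inj₂ (subst (_< f t * g t)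
    (sym (trans (cong (card F *_) G≡0) (*-zeroʳ (card F)))) (*-mono-≤ f>0 g>0))
  conclude (inj₂ (inj₂ (inj₂ (x , y , F≤x , G≤y , inj₁ b)))) = inj₂ (≤-<-trans (*-mono-≤ F≤x G≤y)
    (Bounds⇒*< {t} {f} {g} {j} {x} {y} f>0 g>0 (SF.levelSum-half h₂ hₖ j) (SG.levelSum-half h₂ hₖ j)
      (SF.productSum-small h₂ hₖ j) (SF.next-small h₁) b))
  conclude (inj₂ (inj₂ (inj₂ (x , y , F≤x , G≤y , inj₂ b)))) = inj₂ (≤-<-trans (*-mono-≤ F≤x G≤y)
    (subst₂ _<_ (*-comm y x) (*-comm (g t) (f t))
      (Bounds⇒*< {t} {g} {f} {j} {y} {x} g>0 f>0 (SG.levelSum-half h₂ hₖ j) (SF.levelSum-half h₂ hₖ j)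
        (SG.productSum-small h₂ hₖ j) (SG.next-small h₁) b)))

-- Otherwise a c ≤ a d < b d. This passes equality of the products on to each family, which must
-- then fill its star.
*-≡⇒≡ˡ : ∀ {a b c d} → a ≤ b → c ≤ d → 0 < d → a * c ≡ b * d → a ≡ b
*-≡⇒≡ˡ {a} {b} {c} {d} a≤b c≤d d>0 e with m≤n⇒m<n∨m≡n a≤b
... | inj₂ a≡b = a≡b
... | inj₁ a<b = contradiction e (<⇒≢ (≤-<-trans (*-monoʳ-≤ a c≤d) (*-monoˡ-< d {{>-nonZero d>0}} a<b)))

theorem5p1 : (n k ℓ t q : ℕ) .{{_ : NonZero q}} →
    k < n → ℓ ≤ k → t ≤ ℓ → 1 ≤ t → 2 ≤ q →
    ( n ≥ t +2e ((k ∸ t) * k) / q →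
    (F : Family n k q) → Intersecting t F →
    (card F ≤ ((n ∸ t) C (k ∸ t)) * q ^ (k ∸ t))
    × ((card F ≡ ((n ∸ t) C (k ∸ t)) * q ^ (k ∸ t))
    ⇔ Σ (Subset n) λ X → ∣ X ∣ ≡ t × Σ (Signing q X) λ f₀ → IsStar X f₀ F) )
    ×
    ( n ≥ t +2e (((t + 2) ^ 2 * (k ∸ t)) ⊔ (k ^ 2)) / q →
    (F : Family n k q) (G : Family n ℓ q) → CrossIntersecting t F G →
    (card F * card G
    ≤ ((n ∸ t) C (k ∸ t)) * ((n ∸ t) C (ℓ ∸ t)) * q ^ (k + ℓ ∸ 2 * t))
    × ((card F * card G
    ≡ ((n ∸ t) C (k ∸ t)) * ((n ∸ t) C (ℓ ∸ t)) * q ^ (k + ℓ ∸ 2 * t))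
    ⇔ Σ (Subset n) λ X → ∣ X ∣ ≡ t × Σ (Signing q X) λ f₀ →
    IsStar X f₀ F × IsStar X f₀ G) )
theorem5p1 n k ℓ t q k<n ℓ≤k t≤ℓ 1≤t 2≤q = part₁ , part₂
  where
  t≤k = ≤-trans t≤ℓ ℓ≤k

  part₁ : n ≥ t +2e ((k ∸ t) * k) / q → (F : Family n k q) → Intersecting t F →
    (card F ≤ ((n ∸ t) C (k ∸ t)) * q ^ (k ∸ t))
    × ((card F ≡ ((n ∸ t) C (k ∸ t)) * q ^ (k ∸ t))
      ⇔ Σ (Subset n) λ X → ∣ X ∣ ≡ t × Σ (Signing q X) λ f₀ → IsStar X f₀ F)
  -- Matching on the equation of `weight-≤` replaces the closed form in the goal by
  -- `weight n k q t`, in which the estimates are phrased.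
  part₁ h F int with ((n ∸ t) C (k ∸ t)) * q ^ (k ∸ t) | weight-≤ n k q t≤k
  ... | _ | refl = bound cases , mk⇔ (characterise cases) (λ { (X , refl , f₀ , star) → star⇒card F {X} {f₀} star })
    where
    cases = core-or-< k<n t≤k 1≤t h F int
    bound : Core t F F ⊎ card F < weight n k q t → card F ≤ weight n k q t
    bound (inj₁ (X , refl , f₀ , above , _)) = card≤ F above
    bound (inj₂ lt) = <⇒≤ lt
    characterise : Core t F F ⊎ card F < weight n k q t → card F ≡ weight n k q t →
      Σ (Subset n) λ X → ∣ X ∣ ≡ t × Σ (Signing q X) λ f₀ → IsStar X f₀ F
    characterise (inj₁ (X , refl , f₀ , above , _)) e = X , refl , f₀ , card⇒star F above e
    characterise (inj₂ lt) e = contradiction e (<⇒≢ lt)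

  product : weight n k q t * weight n ℓ q t ≡ ((n ∸ t) C (k ∸ t)) * ((n ∸ t) C (ℓ ∸ t)) * q ^ (k + ℓ ∸ 2 * t)
  product = begin
    weight n k q t * weight n ℓ q t               ≡⟨ cong₂ _*_ (weight-≤ n k q t≤k) (weight-≤ n ℓ q t≤ℓ) ⟩
    (c * q ^ (k ∸ t)) * (d * q ^ (ℓ ∸ t))         ≡⟨ rearrange c d (q ^ (k ∸ t)) (q ^ (ℓ ∸ t)) ⟩
    c * d * (q ^ (k ∸ t) * q ^ (ℓ ∸ t))           ≡⟨ cong (c * d *_) (^-distribˡ-+-* q (k ∸ t) (ℓ ∸ t)) ⟨
    c * d * q ^ (k ∸ t + (ℓ ∸ t))                 ≡⟨ cong (λ z → c * d * q ^ z) exponent ⟩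
    c * d * q ^ (k + ℓ ∸ 2 * t)                   ∎
    where
    open ≡-Reasoning
    c d : ℕ
    c = (n ∸ t) C (k ∸ t)
    d = (n ∸ t) C (ℓ ∸ t)
    rearrange : ∀ c d x y → (c * x) * (d * y) ≡ c * d * (x * y)
    rearrange = solve-∀
    regroup : ∀ t a b → (t + a) + (t + b) ≡ 2 * t + (a + b)
    regroup = solve-∀
    exponent : k ∸ t + (ℓ ∸ t) ≡ k + ℓ ∸ 2 * t
    exponent = begin
      k ∸ t + (ℓ ∸ t)                                  ≡⟨ m+n∸m≡n (2 * t) (k ∸ t + (ℓ ∸ t)) ⟨
      2 * t + (k ∸ t + (ℓ ∸ t)) ∸ 2 * t                ≡⟨ cong (_∸ 2 * t) (regroup t (k ∸ t) (ℓ ∸ t)) ⟨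
      (t + (k ∸ t)) + (t + (ℓ ∸ t)) ∸ 2 * t            ≡⟨ cong₂ (λ x y → x + y ∸ 2 * t) (m+[n∸m]≡n t≤k) (m+[n∸m]≡n t≤ℓ) ⟩
      k + ℓ ∸ 2 * t                                    ∎

  part₂ : n ≥ t +2e (((t + 2) ^ 2 * (k ∸ t)) ⊔ (k ^ 2)) / q →
    (F : Family n k q) (G : Family n ℓ q) → CrossIntersecting t F G →
    (card F * card G ≤ ((n ∸ t) C (k ∸ t)) * ((n ∸ t) C (ℓ ∸ t)) * q ^ (k + ℓ ∸ 2 * t))
    × ((card F * card G ≡ ((n ∸ t) C (k ∸ t)) * ((n ∸ t) C (ℓ ∸ t)) * q ^ (k + ℓ ∸ 2 * t))
      ⇔ Σ (Subset n) λ X → ∣ X ∣ ≡ t × Σ (Signing q X) λ f₀ → IsStar X f₀ F × IsStar X f₀ G)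
  part₂ h F G cross with ((n ∸ t) C (k ∸ t)) * ((n ∸ t) C (ℓ ∸ t)) * q ^ (k + ℓ ∸ 2 * t) | product
  ... | _ | refl = bound cases , mk⇔ (characterise cases)
      (λ { (X , refl , f₀ , starF , starG) → cong₂ _*_ (star⇒card F {X} {f₀} starF) (star⇒card G {X} {f₀} starG) })
    where
    cases = core-or-*< k<n ℓ≤k t≤ℓ 1≤t h F G cross
    bound : Core t F G ⊎ card F * card G < weight n k q t * weight n ℓ q t →
      card F * card G ≤ weight n k q t * weight n ℓ q t
    bound (inj₁ (X , refl , f₀ , aboveF , aboveG)) = *-mono-≤ (card≤ F aboveF) (card≤ G aboveG)
    bound (inj₂ lt) = <⇒≤ lt
    characterise : Core t F G ⊎ card F * card G < weight n k q t * weight n ℓ q t →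
      card F * card G ≡ weight n k q t * weight n ℓ q t →
      Σ (Subset n) λ X → ∣ X ∣ ≡ t × Σ (Signing q X) λ f₀ → IsStar X f₀ F × IsStar X f₀ G
    characterise (inj₁ (X , refl , f₀ , aboveF , aboveG)) e = X , refl , f₀
      , card⇒star F aboveF (*-≡⇒≡ˡ (card≤ F aboveF) (card≤ G aboveG) (weight>0 t≤ℓ (≤-trans ℓ≤k (<⇒≤ k<n))) e)
      , card⇒star G aboveG (*-≡⇒≡ˡ (card≤ G aboveG) (card≤ F aboveF) (weight>0 t≤k (<⇒≤ k<n))
          (trans (*-comm (card G) (card F)) (trans e (*-comm (weight n k q t) (weight n ℓ q t)))))
    characterise (inj₂ lt) e = contradiction e (<⇒≢ lt)
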